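{- For every integer $r\ge 1$, let $P_r=\Phi^+(B_r)$ be the positive-root poset of type $B_r$ graded by $\operatorname{rk}(\alpha)=\operatorname{ht}(\alpha)-1$. Then $$\mathbb{H}_{P_r,\operatorname{rk}}(q,t)=\sum_{w\in\mathcal B_r}q^{\sum_{j\in D(w)}(j-1)}\,t^{|D(w)|}.$$ In particular, every coefficient of the $q$-Zeta numerator $\mathbb{H}_{P_r,\operatorname{rk}}(q,t)$ is a nonnegative integer.
   Context: $q$-Zeta numerator: let $P$ be a finite graded poset with a unique maximum and rank function $\rho:P\to\{0,\dots,H\}$, where $H$ is the maximal rank. For $m\ge 0$ put $A_m(P,\rho;q)=\sum_{x_1\le\cdots\le x_m}q^{\rho(x_1)+\cdots+\rho(x_m)}$ (sum over weak chains in $P$; $A_0=1$). The numerator $\mathbb{H}_{P,\rho}(q,t)$ is the polynomial determined by $\sum_{m\ge 0}A_m(P,\rho;q)t^m=\mathbb{H}_{P,\rho}(q,t)/\prod_{a=0}^{H}(1-q^at)$. Type $B_r$ in $\mathbb{R}^r$ with standard basis $e_1,\dots,e_r$: simple roots $\alpha_i=e_i-e_{i+1}$ ($1\le i<r$), $\alpha_r=e_r$; positive roots $e_i-e_j$ ($i<j$), $e_i$, $e_i+e_j$ ($i<j$). Order: $\alpha\le\beta$ iff $\beta-\alpha$ is a nonnegative integer combination of simple roots. The height $\operatorname{ht}(\alpha)$ is the sum of the simple-root coefficients of $\alpha$. Words: a word in $\{L,R\}$ is a ballot word if every prefix contains at least as many $R$'s as $L$'s. $\mathcal B_r$ is the set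 of words $w\in\{L,R\}^{2r-2}$ whose reversal is a ballot word (for $r=1$, only the empty word). For $w=w_1\cdots w_m$, $D(w)=\{j: w_j=L\text{ and }(j=1\text{ or }w_{j-1}=R)\}$. -}

module Defs where

open import Level using (0ℓ)
open import Algebra.Bundles using (RawRing)
open import Algebra.Definitions.RawSemiring as RawSemiringDefs using ()
open import Data.Bool.Base using (if_then_else_)
open import Data.Empty using (⊥-elim-irr)
open import Data.Fin.Base as Fin using (Fin; zero; suc; toℕ; fromℕ<; inject₁)
open import Data.Fin.Properties as Fin using (toℕ<n; toℕ-fromℕ<; toℕ-inject₁; toℕ-injective)
open import Data.Integer.Base as ℤ using (ℤ; +_; 0ℤ; 1ℤ)
import Data.Integer.Properties as ℤ
open import Data.Integer.Tactic.RingSolver using (solve-∀)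
open import Data.List.Base as List using (List; []; _∷_; _++_; foldr; length; map; filter; upTo; allFin; inits; concatMap)
open import Data.List.Extrema.Nat using (max)
open import Data.List.Membership.Propositional using (_∈_)
open import Data.List.Membership.Propositional.Properties using (∈-map⁺; ∈-map⁻; ∈-++⁺ˡ; ∈-++⁺ʳ; ∈-++⁻; ∈-allFin)
open import Data.List.Relation.Binary.Disjoint.Propositional using (Disjoint)
open import Data.List.Relation.Unary.All using (All; all?)
open import Data.List.Relation.Unary.AllPairs using ([])
open import Data.List.Relation.Unary.Unique.Propositional using (Unique)
import Data.List.Relation.Unary.Unique.Propositional.Properties as Unique
open import Data.Nat.Base as ℕ using (ℕ; zero; suc; NonZero; z≤n; s≤s; z<s; _∸_)
import Data.Nat.Properties as ℕ
open import Data.Product.Base using (∃; _×_; _,_; proj₁; proj₂)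
open import Data.Sum.Base using (_⊎_; inj₁; inj₂)
open import Data.Vec.Base as Vec using (Vec; []; _∷_; lookup; toList)
open import Data.Vec.Functional using (Vector)
open import Data.Vec.Relation.Unary.Linked using (linked?)
open import Function.Base using (_∘_)
import Relation.Binary.Construct.NonStrictToStrict as NonStrictToStrict
open import Relation.Binary.Core using (Rel)
open import Relation.Binary.Definitions using (Maximum; DecidableEquality; tri<; tri≈; tri>)
open import Relation.Binary.PropositionalEquality
open import Relation.Binary.Structures using (IsDecPartialOrder)
open import Relation.Nullary using (¬_; yes; no; does; contradiction; recompute)
open import Relation.Nullary.Decidable using (map′; dec-true; dec-false; _×-dec_; decidable-stable)
import Relation.Unary as U

import Algebra.Properties.AbelianGroup ℤ.+-0-abelianGroup as ℤ+
import Algebra.Properties.CommutativeSemigroup ℕ.+-commutativeSemigroup as ℕ+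
import Algebra.Properties.Semiring.Sum ℕ.+-*-semiring as ℕΣ
import Algebra.Properties.Semiring.Sum ℤ.+-*-semiring as ℤΣ

------------------------------------------------------------------------
-- Formal power series

module ListOps (R : RawRing 0ℓ 0ℓ) where
  open RawRing R

  sumOver prodOver : {A : Set} → List A → (A → Carrier) → Carrier
  sumOver  xs f = foldr (λ x s → f x + s) 0# xs
  prodOver xs f = foldr (λ x p → f x * p) 1# xs

module _ (R : RawRing 0ℓ 0ℓ) where
  open RawRing R

  const : Carrier → ℕ → Carrier
  const c zero    = c
  const c (suc _) = 0#

  indeterminate : ℕ → Carrier
  indeterminate 1 = 1#
  indeterminate _ = 0#

-- A series is its sequence of coefficients; multiplication is the Cauchy
-- product.
infix 9 _⟦X⟧

_⟦X⟧ : RawRing 0ℓ 0ℓ → RawRing 0ℓ 0ℓ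
R ⟦X⟧ = record
  { Carrier = ℕ → Carrier
  ; _≈_     = λ f g → ∀ n → f n ≈ g n
  ; _+_     = λ f g n → f n + g n
  ; _*_     = λ f g n → sumOver (upTo (suc n)) (λ i → f i * g (n ∸ i))
  ; -_      = λ f n → - f n
  ; 0#      = λ _ → 0#
  ; 1#      = const R 1#
  }
  where open RawRing R; open ListOps R

ℤ⟦q⟧ ℤ⟦q⟧⟦t⟧ : RawRing 0ℓ 0ℓ
ℤ⟦q⟧    = ℤ.+-*-rawRing ⟦X⟧
ℤ⟦q⟧⟦t⟧ = ℤ⟦q⟧ ⟦X⟧

module Q where
  open RawRing ℤ⟦q⟧ public
  open RawSemiringDefs rawSemiring public using (_^_)
  open ListOps ℤ⟦q⟧ public

module QT where
  open RawRing ℤ⟦q⟧⟦t⟧ public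
  open RawSemiringDefs rawSemiring public using (_^_)
  open ListOps ℤ⟦q⟧⟦t⟧ public

q : Q.Carrier
q = indeterminate ℤ.+-*-rawRing

t : QT.Carrier
t = indeterminate ℤ⟦q⟧

⌜_⌝ : Q.Carrier → QT.Carrier
⌜_⌝ = const ℤ⟦q⟧

-- The coefficient of q^n t^k.
coefficient : QT.Carrier → (k n : ℕ) → ℤ
coefficient F k n = F k n

------------------------------------------------------------------------
-- Finite graded posets and the q-Zeta numerator

Covers : {A : Set} → Rel A 0ℓ → Rel A 0ℓ
Covers _≤_ x y = x < y × (∀ z → x < z → ¬ z < y)
  where open NonStrictToStrict _≡_ _≤_ using (_<_)

-- The rank of a minimal element is not required to be 0.
record FiniteGradedPoset : Set₁ where
  infix 4 _≤_
  field
    Carrier           : Set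
    _≤_               : Rel Carrier 0ℓ
    isDecPartialOrder : IsDecPartialOrder _≡_ _≤_
    elements          : List Carrier
    elements-complete : ∀ x → x ∈ elements
    elements-unique   : Unique elements
    rank              : Carrier → ℕ
    rank-covers       : ∀ {x y} → Covers _≤_ x y → rank y ≡ suc (rank x)
    top               : Carrier
    top-maximum       : Maximum _≤_ top

  open IsDecPartialOrder isDecPartialOrder public using (_≤?_)

tuples : {A : Set} → List A → ∀ m → List (Vec A m)
tuples xs zero    = [] ∷ []
tuples xs (suc m) = concatMap (λ x → map (x ∷_) (tuples xs m)) xs

module _ (P : FiniteGradedPoset) where
  open FiniteGradedPoset P

  weakChains : ∀ m → List (Vec Carrier m)
  weakChains m = filter (linked? _≤?_) (tuples elements m)

  A : ℕ → Q.Carrier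
  A m = Q.sumOver (weakChains m) (λ xs → q Q.^ Vec.sum (Vec.map rank xs))

  H : ℕ
  H = max 0 (map rank elements)

  -- The defining equation  Σₘ Aₘ tᵐ = ℍ / ∏ₐ (1 − qᵃ t)  with the (invertible)
  -- denominator cleared, read in ℤ⟦q⟧⟦t⟧ ⊇ ℤ[q,t]. The first factor, being the
  -- sequence of the Aₘ, is the series Σₘ Aₘ tᵐ.
  ℍ : QT.Carrier
  ℍ = A QT.* QT.prodOver (upTo (suc H)) (λ a → QT.1# QT.+ QT.- (⌜ q Q.^ a ⌝ QT.* t))

------------------------------------------------------------------------
-- Positive roots of type B
--
-- Indices are 0-based: Fin.zero stands for the index 1.

e : ∀ {r} → Fin r → Vector ℤ r
e i k = if does (i Fin.≟ k) then 1ℤ else 0ℤ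

simpleRoot : ∀ {r} → Fin r → Vector ℤ r
simpleRoot {r} i with suc (toℕ i) ℕ.<? r
... | yes i+1<r = λ k → e i k ℤ.- e (fromℕ< i+1<r) k
... | no  _     = e i

record Ascending (r : ℕ) : Set where
  constructor asc
  field
    lo hi  : Fin r
    .lo<hi : lo Fin.< hi

data PosRoot (r : ℕ) : Set where
  short : Fin r → PosRoot r
  minus : Ascending r → PosRoot r
  plus  : Ascending r → PosRoot r

⟦_⟧ : ∀ {r} → PosRoot r → Vector ℤ r
⟦ short i           ⟧ k = e i k
⟦ minus (asc i j _) ⟧ k = e i k ℤ.- e j k
⟦ plus  (asc i j _) ⟧ k = e i k ℤ.+ e j k

combination : ∀ {r} → Vector ℤ r → Vector ℤ r
combination {r} c k = ℤΣ.sum (λ i → c i ℤ.* simpleRoot i k)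

infix 4 _≼_
_≼_ : ∀ {r} → Rel (PosRoot r) 0ℓ
_≼_ {r} α β = ∃ λ (c : Vector ℕ r) → ∀ k → ⟦ β ⟧ k ℤ.- ⟦ α ⟧ k ≡ combination (+_ ∘ c) k

-- Coefficients in the basis of simple roots, from e_i = α_i + α_{i+1} + ⋯ + α_r.
-- They are proved to expand α in combination-coeff, and to be the only such
-- coefficients by combination-injective.
e-coeff : ∀ {r} → Fin r → Vector ℕ r
e-coeff i k = if does (toℕ i ℕ.≤? toℕ k) then 1 else 0

coeff : ∀ {r} → PosRoot r → Vector ℕ r
coeff (short i)           k = e-coeff i k
coeff (minus (asc i j _)) k = e-coeff i k ∸ e-coeff j k
coeff (plus  (asc i j _)) k = e-coeff i k ℕ.+ e-coeff j k

ht : ∀ {r} → PosRoot r → ℕ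
ht α = ℕΣ.sum (coeff α)

-- No truncation occurs: see ht-positive.
rk : ∀ {r} → PosRoot r → ℕ
rk α = ht α ∸ 1

------------------------------------------------------------------------
-- Expansion in simple roots

private
  prev : ∀ {r} → Vector ℤ r → Vector ℤ r
  prev c zero    = 0ℤ
  prev c (suc k) = c (inject₁ k)

  e-≡ : ∀ {r} {i k : Fin r} → toℕ i ≡ toℕ k → e i k ≡ 1ℤ
  e-≡ {i = i} {k} p rewrite dec-true (i Fin.≟ k) (toℕ-injective p) = refl

  e-≢ : ∀ {r} {i k : Fin r} → toℕ i ≢ toℕ k → e i k ≡ 0ℤ
  e-≢ {i = i} {k} p rewrite dec-false (i Fin.≟ k) (p ∘ cong toℕ) = refl

  e-cong : ∀ {r s} {i k : Fin r} {j l : Fin s} →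
           (toℕ i ≡ toℕ k → toℕ j ≡ toℕ l) → (toℕ j ≡ toℕ l → toℕ i ≡ toℕ k) →
           e i k ≡ e j l
  e-cong {i = i} {k} {j} {l} f g with toℕ i ℕ.≟ toℕ k
  ... | yes p = trans (e-≡ p) (sym (e-≡ (f p)))
  ... | no ¬p = trans (e-≢ ¬p) (sym (e-≢ (¬p ∘ g)))

  simpleRoot-≡ : ∀ {r} (i k : Fin r) → simpleRoot i k ≡ e i k ℤ.- prev (e i) k
  simpleRoot-≡ {r} i k with suc (toℕ i) ℕ.<? r
  simpleRoot-≡ i zero    | yes p =
    cong (λ x → e i zero ℤ.- x) (e-≢ λ eq → ℕ.1+n≢0 (trans (sym (toℕ-fromℕ< p)) eq))
  simpleRoot-≡ i (suc k) | yes p = cong (λ x → e i (suc k) ℤ.- x) (e-cong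
    (λ eq → trans (ℕ.suc-injective (trans (sym (toℕ-fromℕ< p)) eq)) (sym (toℕ-inject₁ k)))
    (λ eq → trans (toℕ-fromℕ< p) (cong suc (trans eq (toℕ-inject₁ k)))))
  simpleRoot-≡ i zero    | no ¬p = sym (ℤ.+-identityʳ _)
  simpleRoot-≡ i (suc k) | no ¬p = sym (trans
    (cong (λ x → e i (suc k) ℤ.- x) (e-≢ λ eq →
      ¬p (s≤s (subst (ℕ._< _) (sym (trans eq (toℕ-inject₁ k))) (toℕ<n k)))))
    (ℤ.+-identityʳ _))

  sum-0 : ∀ {r} (f : Vector ℤ r) → (∀ i → f i ≡ 0ℤ) → ℤΣ.sum f ≡ 0ℤ
  sum-0 {r} f p = trans (ℤΣ.sum-cong-≗ p) (ℤΣ.sum-replicate-zero r)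

  sum-e : ∀ {r} (c : Vector ℤ r) k → ℤΣ.sum (λ i → c i ℤ.* e i k) ≡ c k
  sum-e c zero    = trans
    (cong₂ ℤ._+_ (ℤ.*-identityʳ (c zero)) (sum-0 _ (λ i → ℤ.*-zeroʳ (c (suc i))))) (ℤ.+-identityʳ (c zero))
  sum-e c (suc k) = trans
    (cong₂ ℤ._+_ (ℤ.*-zeroʳ (c zero)) (sum-e (c ∘ suc) k)) (ℤ.+-identityˡ _)

  sum-prev : ∀ {r} (c : Vector ℤ r) k → ℤΣ.sum (λ i → c i ℤ.* prev (e i) k) ≡ prev c k
  sum-prev c zero    = sum-0 _ (λ i → ℤ.*-zeroʳ (c i))
  sum-prev c (suc k) = sum-e c (inject₁ k)

  distrib : ∀ x y z → x ℤ.* (y ℤ.- z) ≡ x ℤ.* y ℤ.+ ℤ.- 1ℤ ℤ.* (x ℤ.* z)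
  distrib = solve-∀

  combination-≡ : ∀ {r} (c : Vector ℤ r) k → combination c k ≡ c k ℤ.- prev c k
  combination-≡ {r} c k = begin
    ℤΣ.sum (λ i → c i ℤ.* simpleRoot i k)
      ≡⟨ ℤΣ.sum-cong-≗ (λ i → trans (cong (c i ℤ.*_) (simpleRoot-≡ i k)) (distrib (c i) _ _)) ⟩
    ℤΣ.sum (λ i → c i ℤ.* e i k ℤ.+ ℤ.- 1ℤ ℤ.* (c i ℤ.* prev (e i) k))
      ≡⟨ ℤΣ.∑-distrib-+ (λ i → c i ℤ.* e i k) _ ⟩
    ℤΣ.sum (λ i → c i ℤ.* e i k) ℤ.+ ℤΣ.sum (λ i → ℤ.- 1ℤ ℤ.* (c i ℤ.* prev (e i) k))
      ≡⟨ cong₂ ℤ._+_ (sum-e c k) (sym (ℤΣ.*-distribˡ-sum (ℤ.- 1ℤ) (λ i → c i ℤ.* prev (e i) k))) ⟩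
    c k ℤ.+ ℤ.- 1ℤ ℤ.* ℤΣ.sum (λ i → c i ℤ.* prev (e i) k)
      ≡⟨ cong (λ x → c k ℤ.+ ℤ.- 1ℤ ℤ.* x) (sum-prev c k) ⟩
    c k ℤ.+ ℤ.- 1ℤ ℤ.* prev c k
      ≡⟨ cong (λ x → c k ℤ.+ x) (ℤ.-1*i≡-i _) ⟩
    c k ℤ.- prev c k ∎
    where open ≡-Reasoning

  combination-cong : ∀ {r} {c d : Vector ℤ r} → c ≗ d → combination c ≗ combination d
  combination-cong p k = ℤΣ.sum-cong-≗ (λ i → cong (ℤ._* simpleRoot i k) (p i))

  prev-cong₂ : ∀ {r} (c d e : Vector ℤ r) (_⊕_ : ℤ → ℤ → ℤ) → 0ℤ ≡ 0ℤ ⊕ 0ℤ →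
               (∀ k → c k ≡ d k ⊕ e k) → ∀ k → prev c k ≡ prev d k ⊕ prev e k
  prev-cong₂ c d e _⊕_ z p zero    = z
  prev-cong₂ c d e _⊕_ z p (suc k) = p (inject₁ k)

  add-lemma : ∀ x y x′ y′ → (x ℤ.+ y) ℤ.- (x′ ℤ.+ y′) ≡ (x ℤ.- x′) ℤ.+ (y ℤ.- y′)
  add-lemma = solve-∀

  sub-lemma : ∀ x y x′ y′ → (x ℤ.- y) ℤ.- (x′ ℤ.- y′) ≡ (x ℤ.- x′) ℤ.- (y ℤ.- y′)
  sub-lemma = solve-∀

combination-+ : ∀ {r} (c d : Vector ℤ r) k →
                combination (λ i → c i ℤ.+ d i) k ≡ combination c k ℤ.+ combination d k
combination-+ c d k = begin
  combination (λ i → c i ℤ.+ d i) k           ≡⟨ combination-≡ (λ i → c i ℤ.+ d i) k ⟩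
  (c k ℤ.+ d k) ℤ.- prev (λ i → c i ℤ.+ d i) k
    ≡⟨ cong (λ x → (c k ℤ.+ d k) ℤ.- x) (prev-cong₂ (λ i → c i ℤ.+ d i) c d ℤ._+_ refl (λ _ → refl) k) ⟩
  (c k ℤ.+ d k) ℤ.- (prev c k ℤ.+ prev d k)   ≡⟨ add-lemma (c k) (d k) (prev c k) (prev d k) ⟩
  (c k ℤ.- prev c k) ℤ.+ (d k ℤ.- prev d k)   ≡⟨ cong₂ ℤ._+_ (combination-≡ c k) (combination-≡ d k) ⟨
  combination c k ℤ.+ combination d k         ∎
  where open ≡-Reasoning

combination-− : ∀ {r} (c d : Vector ℤ r) k →
                combination (λ i → c i ℤ.- d i) k ≡ combination c k ℤ.- combination d k
combination-− c d k = begin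
  combination (λ i → c i ℤ.- d i) k           ≡⟨ combination-≡ (λ i → c i ℤ.- d i) k ⟩
  (c k ℤ.- d k) ℤ.- prev (λ i → c i ℤ.- d i) k
    ≡⟨ cong (λ x → (c k ℤ.- d k) ℤ.- x) (prev-cong₂ (λ i → c i ℤ.- d i) c d ℤ._-_ refl (λ _ → refl) k) ⟩
  (c k ℤ.- d k) ℤ.- (prev c k ℤ.- prev d k)   ≡⟨ sub-lemma (c k) (d k) (prev c k) (prev d k) ⟩
  (c k ℤ.- prev c k) ℤ.- (d k ℤ.- prev d k)   ≡⟨ cong₂ ℤ._-_ (combination-≡ c k) (combination-≡ d k) ⟨
  combination c k ℤ.- combination d k         ∎
  where open ≡-Reasoning

combination-injective : ∀ {r} (c d : Vector ℤ r) → combination c ≗ combination d → c ≗ d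
combination-injective {suc r} c d p = go
  where
  open import Data.Fin.Induction using (<-weakInduction)

  p′ : ∀ k → c k ℤ.- prev c k ≡ d k ℤ.- prev d k
  p′ k = trans (sym (combination-≡ c k)) (trans (p k) (combination-≡ d k))

  go : c ≗ d
  go = <-weakInduction (λ k → c k ≡ d k)
    (ℤ+.∙-cancelʳ (ℤ.- 0ℤ) _ _ (p′ zero))
    (λ i ih → ℤ+.∙-cancelʳ (ℤ.- d (inject₁ i)) _ _
      (subst (λ x → c (suc i) ℤ.- x ≡ _) ih (p′ (suc i))))

e-coeff-1 : ∀ {r} {i k : Fin r} → toℕ i ℕ.≤ toℕ k → e-coeff i k ≡ 1
e-coeff-1 {i = i} {k} p rewrite dec-true (toℕ i ℕ.≤? toℕ k) p = refl

e-coeff-0 : ∀ {r} {i k : Fin r} → toℕ k ℕ.< toℕ i → e-coeff i k ≡ 0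
e-coeff-0 {i = i} {k} p rewrite dec-false (toℕ i ℕ.≤? toℕ k) (ℕ.<⇒≱ p) = refl

e-coeff-mono : ∀ {r} {i j : Fin r} k → i Fin.< j → e-coeff j k ℕ.≤ e-coeff i k
e-coeff-mono {i = i} {j} k i<j with ℕ.≤-<-connex (toℕ j) (toℕ k)
... | inj₂ k<j = ℕ.≤-trans (ℕ.≤-reflexive (e-coeff-0 {i = j} {k} k<j)) z≤n
... | inj₁ j≤k = ℕ.≤-reflexive (trans (e-coeff-1 {i = j} {k} j≤k)
                   (sym (e-coeff-1 {i = i} {k} (ℕ.≤-trans (ℕ.<⇒≤ i<j) j≤k))))

private
  +-∸ : ∀ {m n} → n ℕ.≤ m → + (m ∸ n) ≡ + m ℤ.- + n
  +-∸ {m} {n} n≤m = sym (trans (ℤ.[+m]-[+n]≡m⊖n m n) (ℤ.⊖-≥ n≤m))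

combination-e-coeff : ∀ {r} (i : Fin r) → combination (+_ ∘ e-coeff i) ≗ e i
combination-e-coeff i k = trans (combination-≡ (+_ ∘ e-coeff i) k) (go k)
  where
  go : ∀ k → + e-coeff i k ℤ.- prev (+_ ∘ e-coeff i) k ≡ e i k
  go zero with toℕ i ℕ.≟ 0
  ... | yes p rewrite e-coeff-1 {i = i} {zero} (ℕ.≤-reflexive p) = sym (e-≡ p)
  ... | no ¬p rewrite e-coeff-0 {i = i} {zero} (ℕ.n≢0⇒n>0 ¬p)    = sym (e-≢ ¬p)
  go (suc k) with ℕ.<-cmp (toℕ i) (suc (toℕ k))
  ... | tri< p ¬q _
      rewrite e-coeff-1 {i = i} {suc k} (ℕ.<⇒≤ p)
            | e-coeff-1 {i = i} {inject₁ k} (subst (toℕ i ℕ.≤_) (sym (toℕ-inject₁ k)) (ℕ.≤-pred p))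
            = sym (e-≢ ¬q)
  ... | tri≈ _ q _
      rewrite e-coeff-1 {i = i} {suc k} (ℕ.≤-reflexive q)
            | e-coeff-0 {i = i} {inject₁ k} (ℕ.≤-reflexive (trans (cong suc (toℕ-inject₁ k)) (sym q)))
            = sym (e-≡ q)
  ... | tri> _ ¬q p
      rewrite e-coeff-0 {i = i} {suc k} p
            | e-coeff-0 {i = i} {inject₁ k} (subst (ℕ._< toℕ i) (sym (toℕ-inject₁ k)) (ℕ.<⇒≤ p))
            = sym (e-≢ ¬q)

combination-coeff : ∀ {r} (α : PosRoot r) → combination (+_ ∘ coeff α) ≗ ⟦ α ⟧
combination-coeff (short i) k = combination-e-coeff i k
combination-coeff (minus (asc i j i<j)) k = trans
  (combination-cong (λ l → +-∸ (mono l)) k)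
  (trans (combination-− (+_ ∘ e-coeff i) (+_ ∘ e-coeff j) k) (cong₂ ℤ._-_ (combination-e-coeff i k) (combination-e-coeff j k)))
  where
  mono : ∀ l → e-coeff j l ℕ.≤ e-coeff i l
  mono l = e-coeff-mono {i = i} {j} l (recompute (i Fin.<? j) i<j)
combination-coeff (plus (asc i j _)) k =
  trans (combination-+ (+_ ∘ e-coeff i) (+_ ∘ e-coeff j) k) (cong₂ ℤ._+_ (combination-e-coeff i k) (combination-e-coeff j k))

------------------------------------------------------------------------
-- Coordinates on the root poset
--
-- The root e_i − e_j has coordinates (i , j), e_i has coordinates (i , r) and
-- e_i + e_j has coordinates (i , 2r − j), with 0-based i and j. This identifies
-- the root poset with { (a , b) ∣ a < b, a + b < 2r }, where b increases and a
-- decreases upwards, and ht = b − a.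

lower upper : ∀ {r} → PosRoot r → ℕ
lower (short i)           = toℕ i
lower (minus (asc i j _)) = toℕ i
lower (plus  (asc i j _)) = toℕ i

upper {r} (short i)           = r
upper {r} (minus (asc i j _)) = toℕ j
upper {r} (plus  (asc i j _)) = r ℕ.+ (r ∸ toℕ j)

≼⇒coeff : ∀ {r} {α β : PosRoot r} → α ≼ β → ∀ k → coeff α k ℕ.≤ coeff β k
≼⇒coeff {r} {α} {β} (c , p) k = ℕ.m+n≤o⇒n≤o (c k) (ℕ.≤-reflexive (ℤ.+-injective (begin
  + (c k ℕ.+ coeff α k)                             ≡⟨ ℤ.pos-+ (c k) _ ⟩
  + c k ℤ.+ + coeff α k                             ≡⟨ cong (λ x → x ℤ.+ + coeff α k) (eq k) ⟨
  (+ coeff β k ℤ.- + coeff α k) ℤ.+ + coeff α k     ≡⟨ ℤ+.//-rightDividesˡ (+ coeff α k) (+ coeff β k) ⟩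
  + coeff β k                                       ∎)))
  where
  open ≡-Reasoning
  eq : ∀ k → + coeff β k ℤ.- + coeff α k ≡ + c k
  eq = combination-injective (λ k → + coeff β k ℤ.- + coeff α k) (+_ ∘ c) λ k →
    trans (combination-− (+_ ∘ coeff β) (+_ ∘ coeff α) k)
      (trans (cong₂ ℤ._-_ (combination-coeff β k) (combination-coeff α k)) (p k))

coeff⇒≼ : ∀ {r} {α β : PosRoot r} → (∀ k → coeff α k ℕ.≤ coeff β k) → α ≼ β
coeff⇒≼ {r} {α} {β} p = (λ k → coeff β k ∸ coeff α k) , λ k → sym (begin
  combination (λ k → + (coeff β k ∸ coeff α k)) k
    ≡⟨ combination-cong (λ l → +-∸ (p l)) k ⟩
  combination (λ k → + coeff β k ℤ.- + coeff α k) k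
    ≡⟨ combination-− (+_ ∘ coeff β) (+_ ∘ coeff α) k ⟩
  combination (+_ ∘ coeff β) k ℤ.- combination (+_ ∘ coeff α) k
    ≡⟨ cong₂ ℤ._-_ (combination-coeff β k) (combination-coeff α k) ⟩
  ⟦ β ⟧ k ℤ.- ⟦ α ⟧ k ∎)
  where open ≡-Reasoning

private
  lo<hi′ : ∀ {r} (p : Ascending r) → Ascending.lo p Fin.< Ascending.hi p
  lo<hi′ (asc i j i<j) = recompute (i Fin.<? j) i<j

  e-coeff-≥1 : ∀ {r} {i k : Fin r} → 1 ℕ.≤ e-coeff i k → toℕ i ℕ.≤ toℕ k
  e-coeff-≥1 {i = i} {k} p with ℕ.≤-<-connex (toℕ i) (toℕ k)
  ... | inj₁ q = q
  ... | inj₂ q = contradiction (subst (1 ℕ.≤_) (e-coeff-0 {i = i} {k} q) p) λ ()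

  e-coeff-≤1 : ∀ {r} (i k : Fin r) → e-coeff i k ℕ.≤ 1
  e-coeff-≤1 i k with ℕ.≤-<-connex (toℕ i) (toℕ k)
  ... | inj₁ p = ℕ.≤-reflexive (e-coeff-1 {i = i} {k} p)
  ... | inj₂ p = ℕ.≤-trans (ℕ.≤-reflexive (e-coeff-0 {i = i} {k} p)) z≤n

  e-coeff-⊤ : ∀ {r} {i k : Fin r} → toℕ i ℕ.≤ toℕ k → 1 ℕ.≤ e-coeff i k
  e-coeff-⊤ p = ℕ.≤-reflexive (sym (e-coeff-1 p))

  m≤1⇒≱2 : ∀ {m} → m ℕ.≤ 1 → ¬ 2 ℕ.≤ m
  m≤1⇒≱2 p q = ℕ.1+n≰n (ℕ.≤-trans q p)

  r<2r∸ : ∀ {r} (j : Fin r) → r ℕ.< r ℕ.+ (r ∸ toℕ j)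
  r<2r∸ {r} j = ℕ.m<m+n r (ℕ.m<n⇒0<n∸m (toℕ<n j))

  coeff-≥1⇒lower : ∀ {r} (α : PosRoot r) k → 1 ℕ.≤ coeff α k → lower α ℕ.≤ toℕ k
  coeff-≥1⇒lower (short i) k p = e-coeff-≥1 {i = i} {k} p
  coeff-≥1⇒lower (minus (asc i j _)) k p = e-coeff-≥1 (ℕ.≤-trans p (ℕ.m∸n≤m _ (e-coeff j k)))
  coeff-≥1⇒lower (plus α@(asc i j _)) k p with ℕ.≤-<-connex (toℕ i) (toℕ k)
  ... | inj₁ q = q
  ... | inj₂ q = ℕ.≤-trans (ℕ.<⇒≤ (lo<hi′ α)) (e-coeff-≥1 {i = j} {k}
                   (subst (λ x → 1 ℕ.≤ x ℕ.+ e-coeff j k) (e-coeff-0 {i = i} {k} q) p))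

  coeff-≥1⇒upper : ∀ {r} (α : PosRoot r) k → 1 ℕ.≤ coeff α k → toℕ k ℕ.< upper α
  coeff-≥1⇒upper (short i) k p = toℕ<n k
  coeff-≥1⇒upper (minus (asc i j _)) k p with ℕ.≤-<-connex (toℕ j) (toℕ k)
  ... | inj₂ q = q
  ... | inj₁ q = contradiction (ℕ.≤-trans
                   (subst (λ x → 1 ℕ.≤ e-coeff i k ∸ x) (e-coeff-1 {i = j} {k} q) p)
                   (ℕ.∸-monoˡ-≤ 1 (e-coeff-≤1 i k))) λ ()
  coeff-≥1⇒upper (plus (asc i j _)) k p = ℕ.<-trans (toℕ<n k) (r<2r∸ j)

  coeff-≥1 : ∀ {r} (α : PosRoot r) k → lower α ℕ.≤ toℕ k → toℕ k ℕ.< upper α → 1 ℕ.≤ coeff α k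
  coeff-≥1 (short i) k p _ = e-coeff-⊤ p
  coeff-≥1 (minus (asc i j _)) k p q rewrite e-coeff-1 {i = i} {k} p | e-coeff-0 {i = j} {k} q = ℕ.≤-refl
  coeff-≥1 (plus (asc i j _)) k p _ = ℕ.≤-trans (e-coeff-⊤ p) (ℕ.m≤m+n _ _)

  coeff-≥2⇒ : ∀ {r} (α : PosRoot r) k → 2 ℕ.≤ coeff α k → r ℕ.+ r ℕ.≤ toℕ k ℕ.+ upper α
  coeff-≥2⇒ (short i) k p = contradiction p (m≤1⇒≱2 (e-coeff-≤1 i k))
  coeff-≥2⇒ (minus (asc i j _)) k p =
    contradiction p (m≤1⇒≱2 (ℕ.≤-trans (ℕ.m∸n≤m _ (e-coeff j k)) (e-coeff-≤1 i k)))
  coeff-≥2⇒ {r} (plus (asc i j _)) k p = begin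
    r ℕ.+ r                          ≡⟨ cong (r ℕ.+_) (ℕ.m+[n∸m]≡n (ℕ.<⇒≤ (toℕ<n j))) ⟨
    r ℕ.+ (toℕ j ℕ.+ (r ∸ toℕ j))    ≤⟨ ℕ.+-monoʳ-≤ r (ℕ.+-monoˡ-≤ _ j≤k) ⟩
    r ℕ.+ (toℕ k ℕ.+ (r ∸ toℕ j))    ≡⟨ ℕ+.x∙yz≈y∙xz r (toℕ k) _ ⟩
    toℕ k ℕ.+ (r ℕ.+ (r ∸ toℕ j))    ∎
    where
    open ℕ.≤-Reasoning
    j≤k : toℕ j ℕ.≤ toℕ k
    j≤k = e-coeff-≥1 (ℕ.≤-pred (ℕ.≤-trans p (ℕ.+-monoˡ-≤ (e-coeff j k) (e-coeff-≤1 i k))))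

  coeff-≥2 : ∀ {r} (α : PosRoot r) k → r ℕ.+ r ℕ.≤ toℕ k ℕ.+ upper α → 2 ℕ.≤ coeff α k
  coeff-≥2 {r} (short i) k p = contradiction p (ℕ.<⇒≱ (ℕ.+-monoˡ-< r (toℕ<n k)))
  coeff-≥2 (minus (asc i j _)) k p =
    contradiction p (ℕ.<⇒≱ (ℕ.+-mono-<-≤ (toℕ<n k) (ℕ.<⇒≤ (toℕ<n j))))
  coeff-≥2 {r} (plus α@(asc i j _)) k p =
    ℕ.+-mono-≤ (e-coeff-⊤ (ℕ.≤-trans (ℕ.<⇒≤ (lo<hi′ α)) j≤k)) (e-coeff-⊤ j≤k)
    where
    open ℕ.≤-Reasoning
    j≤k : toℕ j ℕ.≤ toℕ k
    j≤k = ℕ.+-cancelʳ-≤ (r ∸ toℕ j) _ _ (ℕ.+-cancelˡ-≤ r _ _ (begin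
      r ℕ.+ (toℕ j ℕ.+ (r ∸ toℕ j))    ≡⟨ cong (r ℕ.+_) (ℕ.m+[n∸m]≡n (ℕ.<⇒≤ (toℕ<n j))) ⟩
      r ℕ.+ r                          ≤⟨ p ⟩
      toℕ k ℕ.+ (r ℕ.+ (r ∸ toℕ j))    ≡⟨ ℕ+.x∙yz≈y∙xz (toℕ k) r _ ⟩
      r ℕ.+ (toℕ k ℕ.+ (r ∸ toℕ j))    ∎))

  coeff-≤2 : ∀ {r} (α : PosRoot r) k → coeff α k ℕ.≤ 2
  coeff-≤2 (short i)           k = ℕ.≤-trans (e-coeff-≤1 i k) (s≤s z≤n)
  coeff-≤2 (minus (asc i j _)) k =
    ℕ.≤-trans (ℕ.m∸n≤m _ (e-coeff j k)) (ℕ.≤-trans (e-coeff-≤1 i k) (s≤s z≤n))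
  coeff-≤2 (plus (asc i j _))  k = ℕ.+-mono-≤ (e-coeff-≤1 i k) (e-coeff-≤1 j k)

lower<upper : ∀ {r} (α : PosRoot r) → lower α ℕ.< upper α
lower<upper (short i)            = toℕ<n i
lower<upper (minus α)            = lo<hi′ α
lower<upper (plus (asc i j _))   = ℕ.<-trans (toℕ<n i) (r<2r∸ j)

lower+upper< : ∀ {r} (α : PosRoot r) → lower α ℕ.+ upper α ℕ.< r ℕ.+ r
lower+upper< {r} (short i)           = ℕ.+-monoˡ-< r (toℕ<n i)
lower+upper< (minus (asc i j _))     = ℕ.+-mono-< (toℕ<n i) (toℕ<n j)
lower+upper< {r} (plus α@(asc i j _)) = begin-strict
  toℕ i ℕ.+ (r ℕ.+ (r ∸ toℕ j))  <⟨ ℕ.+-monoˡ-< _ (lo<hi′ α) ⟩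
  toℕ j ℕ.+ (r ℕ.+ (r ∸ toℕ j))  ≡⟨ ℕ+.x∙yz≈y∙xz (toℕ j) r _ ⟩
  r ℕ.+ (toℕ j ℕ.+ (r ∸ toℕ j))  ≡⟨ cong (r ℕ.+_) (ℕ.m+[n∸m]≡n (ℕ.<⇒≤ (toℕ<n j))) ⟩
  r ℕ.+ r                        ∎
  where open ℕ.≤-Reasoning

≼⇒coords : ∀ {r} {α β : PosRoot r} → α ≼ β → lower β ℕ.≤ lower α × upper α ℕ.≤ upper β
≼⇒coords {r} {α} {β} α≼β = low α mono , up α mono
  where
  mono : ∀ k → coeff α k ℕ.≤ coeff β k
  mono = ≼⇒coeff {α = α} {β} α≼β

  low : ∀ α → (∀ k → coeff α k ℕ.≤ coeff β k) → lower β ℕ.≤ lower α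
  low α@(short i) m =
    coeff-≥1⇒lower β i (ℕ.≤-trans (coeff-≥1 α i ℕ.≤-refl (lower<upper α)) (m i))
  low α@(minus (asc i j _)) m =
    coeff-≥1⇒lower β i (ℕ.≤-trans (coeff-≥1 α i ℕ.≤-refl (lower<upper α)) (m i))
  low α@(plus (asc i j _)) m =
    coeff-≥1⇒lower β i (ℕ.≤-trans (coeff-≥1 α i ℕ.≤-refl (lower<upper α)) (m i))

  below : ∀ α b → lower α ℕ.< b → b ℕ.≤ r → b ≡ upper α →
          (∀ k → coeff α k ℕ.≤ coeff β k) → b ℕ.≤ upper β
  below α (suc b) a<b b<r eq m =
    subst (ℕ._< upper β) (toℕ-fromℕ< b<r) (coeff-≥1⇒upper β k (ℕ.≤-trans (coeff-≥1 α k
      (subst (lower α ℕ.≤_) (sym (toℕ-fromℕ< b<r)) (ℕ.≤-pred a<b))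
      (subst (ℕ._< upper α) (sym (toℕ-fromℕ< b<r)) (ℕ.≤-reflexive eq))) (m k)))
    where k = fromℕ< b<r

  up : ∀ α → (∀ k → coeff α k ℕ.≤ coeff β k) → upper α ℕ.≤ upper β
  up α@(short i) m = below α r (lower<upper α) ℕ.≤-refl refl m
  up α@(minus (asc i j _)) m = below α (toℕ j) (lower<upper α) (ℕ.<⇒≤ (toℕ<n j)) refl m
  up α@(plus (asc i j _)) m = ℕ.+-cancelˡ-≤ (toℕ j) _ _ (begin
    toℕ j ℕ.+ (r ℕ.+ (r ∸ toℕ j))  ≡⟨ eq ⟩
    r ℕ.+ r                        ≤⟨ coeff-≥2⇒ β j (ℕ.≤-trans (coeff-≥2 α j (ℕ.≤-reflexive (sym eq))) (m j)) ⟩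
    toℕ j ℕ.+ upper β              ∎)
    where
    open ℕ.≤-Reasoning
    eq : toℕ j ℕ.+ (r ℕ.+ (r ∸ toℕ j)) ≡ r ℕ.+ r
    eq = trans (ℕ+.x∙yz≈y∙xz (toℕ j) r _) (cong (r ℕ.+_) (ℕ.m+[n∸m]≡n (ℕ.<⇒≤ (toℕ<n j))))

coords⇒≼ : ∀ {r} {α β : PosRoot r} → lower β ℕ.≤ lower α → upper α ℕ.≤ upper β → α ≼ β
coords⇒≼ {r} {α} {β} p q = coeff⇒≼ {α = α} {β} λ k → go k (coeff α k) refl
  where
  go : ∀ k n → coeff α k ≡ n → n ℕ.≤ coeff β k
  go k 0 eq = z≤n
  go k 1 eq = coeff-≥1 β k
    (ℕ.≤-trans p (coeff-≥1⇒lower α k (ℕ.≤-reflexive (sym eq))))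
    (ℕ.<-≤-trans (coeff-≥1⇒upper α k (ℕ.≤-reflexive (sym eq))) q)
  go k 2 eq = coeff-≥2 β k
    (ℕ.≤-trans (coeff-≥2⇒ α k (ℕ.≤-reflexive (sym eq))) (ℕ.+-monoʳ-≤ (toℕ k) q))
  go k (suc (suc (suc n))) eq =
    contradiction (subst (ℕ._≤ 2) eq (coeff-≤2 α k)) λ { (s≤s (s≤s ())) }

coords-injective : ∀ {r} (α β : PosRoot r) → lower α ≡ lower β → upper α ≡ upper β → α ≡ β
coords-injective (short i) (short i′) p q = cong short (toℕ-injective p)
coords-injective (short i) (minus (asc i′ j′ _)) p q = contradiction (sym q) (ℕ.<⇒≢ (toℕ<n j′))
coords-injective (short i) (plus (asc i′ j′ _)) p q = contradiction q (ℕ.<⇒≢ (r<2r∸ j′))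
coords-injective (minus (asc i j _)) (short i′) p q = contradiction q (ℕ.<⇒≢ (toℕ<n j))
coords-injective (minus (asc i j _)) (minus (asc i′ j′ _)) p q
  with refl ← toℕ-injective p | refl ← toℕ-injective q = refl
coords-injective (minus (asc i j _)) (plus (asc i′ j′ _)) p q =
  contradiction q (ℕ.<⇒≢ (ℕ.<-trans (toℕ<n j) (r<2r∸ j′)))
coords-injective (plus (asc i j _)) (short i′) p q = contradiction (sym q) (ℕ.<⇒≢ (r<2r∸ j))
coords-injective (plus (asc i j _)) (minus (asc i′ j′ _)) p q =
  contradiction (sym q) (ℕ.<⇒≢ (ℕ.<-trans (toℕ<n j′) (r<2r∸ j)))
coords-injective {r} (plus (asc i j _)) (plus (asc i′ j′ _)) p q
  with refl ← toℕ-injective p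
     | refl ← toℕ-injective (ℕ.∸-cancelˡ-≡ (ℕ.<⇒≤ (toℕ<n j)) (ℕ.<⇒≤ (toℕ<n j′)) (ℕ.+-cancelˡ-≡ r _ _ q))
  = refl

coords-surjective : ∀ {r} a b → a ℕ.< b → a ℕ.+ b ℕ.< r ℕ.+ r →
                    ∃ λ (α : PosRoot r) → lower α ≡ a × upper α ≡ b
coords-surjective {r} a b a<b a+b<2r with ℕ.<-cmp b r
... | tri< b<r _ _ =
  minus (asc (fromℕ< a<r) (fromℕ< b<r) (subst₂ ℕ._<_ (sym (toℕ-fromℕ< a<r)) (sym (toℕ-fromℕ< b<r)) a<b)) ,
  toℕ-fromℕ< a<r , toℕ-fromℕ< b<r
  where a<r = ℕ.<-trans a<b b<r
... | tri≈ _ refl _ = short (fromℕ< a<b) , toℕ-fromℕ< a<b , refl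
... | tri> _ _ r<b =
  plus (asc (fromℕ< a<r) (fromℕ< j<r) (subst₂ ℕ._<_ (sym (toℕ-fromℕ< a<r)) (sym (toℕ-fromℕ< j<r)) a<j)) ,
  toℕ-fromℕ< a<r , (begin
    r ℕ.+ (r ∸ toℕ (fromℕ< j<r))  ≡⟨ cong (λ x → r ℕ.+ (r ∸ x)) (toℕ-fromℕ< j<r) ⟩
    r ℕ.+ (r ∸ (r ∸ (b ∸ r)))     ≡⟨ cong (r ℕ.+_) (ℕ.m∸[m∸n]≡n b∸r≤r) ⟩
    r ℕ.+ (b ∸ r)                 ≡⟨ ℕ.m+[n∸m]≡n (ℕ.<⇒≤ r<b) ⟩
    b                             ∎)
  where
  open ≡-Reasoning
  a+[b∸r]<r : a ℕ.+ (b ∸ r) ℕ.< r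
  a+[b∸r]<r = ℕ.+-cancelʳ-< r _ _ (subst (ℕ._< r ℕ.+ r)
    (trans (cong (a ℕ.+_) (sym (ℕ.m∸n+n≡m (ℕ.<⇒≤ r<b)))) (sym (ℕ.+-assoc a _ r))) a+b<2r)
  a<r : a ℕ.< r
  a<r = ℕ.≤-<-trans (ℕ.m≤m+n a _) a+[b∸r]<r
  b∸r≤r : b ∸ r ℕ.≤ r
  b∸r≤r = ℕ.<⇒≤ (ℕ.≤-<-trans (ℕ.m≤n+m _ a) a+[b∸r]<r)
  j<r : r ∸ (b ∸ r) ℕ.< r
  j<r = ℕ.∸-monoʳ-< (ℕ.m<n⇒0<n∸m r<b) b∸r≤r
  a<j : a ℕ.< r ∸ (b ∸ r)
  a<j = ℕ.m+n≤o⇒m≤o∸n (suc a) a+[b∸r]<r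

≼-isDecPartialOrder : ∀ {r} → IsDecPartialOrder _≡_ (_≼_ {r})
≼-isDecPartialOrder {r} = record
  { isPartialOrder = record
    { isPreorder = record
      { isEquivalence = isEquivalence
      ; reflexive     = λ { {α} refl → coords⇒≼ {α = α} {α} ℕ.≤-refl ℕ.≤-refl }
      ; trans         = λ {α} {β} {γ} p q →
          let (p₁ , p₂) = ≼⇒coords {α = α} {β} p
              (q₁ , q₂) = ≼⇒coords {α = β} {γ} q
          in coords⇒≼ {α = α} {γ} (ℕ.≤-trans q₁ p₁) (ℕ.≤-trans p₂ q₂)
      }
    ; antisym = λ {α} {β} p q →
        let (p₁ , p₂) = ≼⇒coords {α = α} {β} p
            (q₁ , q₂) = ≼⇒coords {α = β} {α} q
        in coords-injective α β (ℕ.≤-antisym q₁ p₁) (ℕ.≤-antisym p₂ q₂)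
    }
  ; _≟_  = λ α β → map′ (λ (p , q) → coords-injective α β p q) (λ { refl → refl , refl })
                     (lower α ℕ.≟ lower β ×-dec upper α ℕ.≟ upper β)
  ; _≤?_ = λ α β → map′ (λ (p , q) → coords⇒≼ {α = α} {β} p q) (≼⇒coords {α = α} {β})
                     (lower β ℕ.≤? lower α ×-dec upper α ℕ.≤? upper β)
  }

private
  sum-1 : ∀ n → ℕΣ.sum {n} (λ _ → 1) ≡ n
  sum-1 zero    = refl
  sum-1 (suc n) = cong suc (sum-1 n)

  -- e_i has height r − i
  sum-e-coeff : ∀ {r} (i : Fin r) → ℕΣ.sum (e-coeff i) ℕ.+ toℕ i ≡ r
  sum-e-coeff {suc r} zero    = trans (ℕ.+-identityʳ _) (cong suc (sum-1 r))
  sum-e-coeff {suc r} (suc i) = trans (ℕ.+-suc _ (toℕ i)) (cong suc (trans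
    (cong (ℕ._+ toℕ i) (ℕΣ.sum-cong-≗ step)) (sum-e-coeff i)))
    where
    step : ∀ k → e-coeff (suc i) (suc k) ≡ e-coeff i k
    step k with ℕ.≤-<-connex (toℕ i) (toℕ k)
    ... | inj₁ p = trans (e-coeff-1 {i = suc i} {suc k} (s≤s p)) (sym (e-coeff-1 {i = i} {k} p))
    ... | inj₂ p = trans (e-coeff-0 {i = suc i} {suc k} (s≤s p)) (sym (e-coeff-0 {i = i} {k} p))

ht+lower : ∀ {r} (α : PosRoot r) → ht α ℕ.+ lower α ≡ upper α
ht+lower (short i) = sum-e-coeff i
ht+lower {r} (minus α@(asc i j _)) = ℕ.+-cancelˡ-≡ Sj _ _ (begin
  Sj ℕ.+ (S ℕ.+ toℕ i)   ≡⟨ ℕ+.x∙yz≈yx∙z Sj S (toℕ i) ⟩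
  (S ℕ.+ Sj) ℕ.+ toℕ i   ≡⟨ cong (ℕ._+ toℕ i) (ℕΣ.∑-distrib-+ (λ k → e-coeff i k ∸ e-coeff j k) (e-coeff j)) ⟨
  ℕΣ.sum (λ k → e-coeff i k ∸ e-coeff j k ℕ.+ e-coeff j k) ℕ.+ toℕ i
    ≡⟨ cong (ℕ._+ toℕ i) (ℕΣ.sum-cong-≗ (λ k → ℕ.m∸n+n≡m (e-coeff-mono {i = i} {j} k (lo<hi′ α)))) ⟩
  ℕΣ.sum (e-coeff i) ℕ.+ toℕ i ≡⟨ sum-e-coeff i ⟩
  r                      ≡⟨ sum-e-coeff j ⟨
  Sj ℕ.+ toℕ j           ∎)
  where
  open ≡-Reasoning
  S  = ℕΣ.sum (λ k → e-coeff i k ∸ e-coeff j k)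
  Sj = ℕΣ.sum (e-coeff j)
ht+lower {r} (plus (asc i j _)) = begin
  ℕΣ.sum (λ k → e-coeff i k ℕ.+ e-coeff j k) ℕ.+ toℕ i
    ≡⟨ cong (ℕ._+ toℕ i) (ℕΣ.∑-distrib-+ (e-coeff i) (e-coeff j)) ⟩
  (Si ℕ.+ Sj) ℕ.+ toℕ i   ≡⟨ ℕ+.xy∙z≈xz∙y Si Sj (toℕ i) ⟩
  (Si ℕ.+ toℕ i) ℕ.+ Sj   ≡⟨ cong₂ ℕ._+_ (sum-e-coeff i)
                               (trans (sym (ℕ.m+n∸n≡m Sj (toℕ j))) (cong (_∸ toℕ j) (sum-e-coeff j))) ⟩
  r ℕ.+ (r ∸ toℕ j)       ∎
  where
  open ≡-Reasoning
  Si = ℕΣ.sum (e-coeff i)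
  Sj = ℕΣ.sum (e-coeff j)

ht-positive : ∀ {r} (α : PosRoot r) → 0 ℕ.< ht α
ht-positive α = ℕ.+-cancelʳ-< (lower α) 0 (ht α) (subst (lower α ℕ.<_) (sym (ht+lower α)) (lower<upper α))

private
  rk-suc : ∀ {r} (α β : PosRoot r) → ht β ≡ suc (ht α) → rk β ≡ suc (rk α)
  rk-suc α β eq = trans (cong (_∸ 1) eq) (sym (ℕ.m+[n∸m]≡n (ht-positive α)))

  module CoverRank {r : ℕ} (α β : PosRoot r) (α⋖β : Covers _≼_ α β) where
    open ≡-Reasoning

    coords : lower β ℕ.≤ lower α × upper α ℕ.≤ upper β
    coords = ≼⇒coords {α = α} {β} (proj₁ (proj₁ α⋖β))

    squeeze : ∀ γ → α ≼ γ → α ≢ γ → γ ≼ β → γ ≡ β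
    squeeze γ α≼γ α≢γ γ≼β = decidable-stable (≼-isDecPartialOrder .IsDecPartialOrder._≟_ γ β)
      λ γ≢β → proj₂ α⋖β γ (α≼γ , α≢γ) (γ≼β , γ≢β)

    step-lower : ∀ a → suc a ≡ lower α → lower β ℕ.< lower α →
                 (∃ λ (γ : PosRoot r) → lower γ ≡ a × upper γ ≡ upper α) → ht β ≡ suc (ht α)
    step-lower a eq b<a (γ , lγ , uγ) = subst (λ x → ht x ≡ suc (ht α)) γ≡β
      (ℕ.+-cancelʳ-≡ a (ht γ) (suc (ht α)) (begin
        ht γ ℕ.+ a              ≡⟨ cong (ht γ ℕ.+_) lγ ⟨
        ht γ ℕ.+ lower γ        ≡⟨ ht+lower γ ⟩
        upper γ                 ≡⟨ uγ ⟩
        upper α                 ≡⟨ ht+lower α ⟨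
        ht α ℕ.+ lower α        ≡⟨ cong (ht α ℕ.+_) eq ⟨
        ht α ℕ.+ suc a          ≡⟨ ℕ.+-suc (ht α) a ⟩
        suc (ht α ℕ.+ a)        ∎))
      where
      γ≡β : γ ≡ β
      γ≡β = squeeze γ
        (coords⇒≼ {α = α} {γ} (subst₂ ℕ._≤_ (sym lγ) eq (ℕ.n≤1+n a)) (ℕ.≤-reflexive (sym uγ)))
        (λ α≡γ → ℕ.1+n≢n (trans eq (trans (cong lower α≡γ) lγ)))
        (coords⇒≼ {α = γ} {β}
          (subst (lower β ℕ.≤_) (sym lγ) (ℕ.≤-pred (subst (lower β ℕ.<_) (sym eq) b<a)))
          (subst (ℕ._≤ upper β) (sym uγ) (proj₂ coords)))

    step-upper : lower β ≡ lower α → upper α ℕ.< upper β →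
                 (∃ λ (γ : PosRoot r) → lower γ ≡ lower α × upper γ ≡ suc (upper α)) →
                 ht β ≡ suc (ht α)
    step-upper b≡a u< (γ , lγ , uγ) = subst (λ x → ht x ≡ suc (ht α)) γ≡β
      (ℕ.+-cancelʳ-≡ (lower α) (ht γ) (suc (ht α)) (begin
        ht γ ℕ.+ lower α        ≡⟨ cong (ht γ ℕ.+_) lγ ⟨
        ht γ ℕ.+ lower γ        ≡⟨ ht+lower γ ⟩
        upper γ                 ≡⟨ uγ ⟩
        suc (upper α)           ≡⟨ cong suc (ht+lower α) ⟨
        suc (ht α ℕ.+ lower α)  ∎))
      where
      γ≡β : γ ≡ β
      γ≡β = squeeze γ
        (coords⇒≼ {α = α} {γ} (ℕ.≤-reflexive lγ) (subst (upper α ℕ.≤_) (sym uγ) (ℕ.n≤1+n _)))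
        (λ α≡γ → ℕ.1+n≢n (sym (trans (cong upper α≡γ) uγ)))
        (coords⇒≼ {α = γ} {β} (ℕ.≤-reflexive (trans b≡a (sym lγ))) (subst (ℕ._≤ upper β) (sym uγ) u<))

    ht-suc : ∀ a → a ≡ lower α → lower β ℕ.< lower α ⊎ lower β ≡ lower α →
             upper α ℕ.< upper β ⊎ upper α ≡ upper β → ht β ≡ suc (ht α)
    ht-suc zero    eq (inj₁ b<a) _ = contradiction (subst (lower β ℕ.<_) (sym eq) b<a) λ ()
    ht-suc (suc a) eq (inj₁ b<a) _ = step-lower a eq b<a (coords-surjective a (upper α)
      (ℕ.<-trans (ℕ.≤-reflexive eq) (lower<upper α))
      (ℕ.<-trans (ℕ.+-monoˡ-< (upper α) (ℕ.≤-reflexive eq)) (lower+upper< α)))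
    ht-suc _ _ (inj₂ b≡a) (inj₂ u≡) =
      contradiction (coords-injective α β (sym b≡a) u≡) (proj₂ (proj₁ α⋖β))
    ht-suc _ _ (inj₂ b≡a) (inj₁ u<) = step-upper b≡a u< (coords-surjective (lower α) (suc (upper α))
      (ℕ.<-trans (lower<upper α) ℕ.≤-refl)
      (ℕ.≤-<-trans (ℕ.+-mono-≤ (ℕ.≤-reflexive (sym b≡a)) u<) (lower+upper< β)))

rk-covers : ∀ {r} {α β : PosRoot r} → Covers _≼_ α β → rk β ≡ suc (rk α)
rk-covers {r} {α} {β} α⋖β = rk-suc α β
  (ht-suc (lower α) refl (ℕ.m≤n⇒m<n∨m≡n (proj₁ coords)) (ℕ.m≤n⇒m<n∨m≡n (proj₂ coords)))
  where open CoverRank α β α⋖β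

------------------------------------------------------------------------
-- The root poset

first-asc : ∀ {r} → Fin r → Ascending (suc r)
first-asc j = asc zero (suc j) z<s

suc-asc : ∀ {r} → Ascending r → Ascending (suc r)
suc-asc (asc i j i<j) = asc (suc i) (suc j) (s≤s i<j)

ascending : ∀ r → List (Ascending r)
ascending zero    = []
ascending (suc r) = map first-asc (allFin r) ++ map suc-asc (ascending r)

posRoots : ∀ r → List (PosRoot r)
posRoots r = map short (allFin r) ++ map minus (ascending r) ++ map plus (ascending r)

private
  ascending-complete : ∀ {r} (p : Ascending r) → p ∈ ascending r
  ascending-complete {suc r} (asc zero (suc j) _) = ∈-++⁺ˡ (∈-map⁺ first-asc (∈-allFin j))
  ascending-complete {suc r} (asc (suc i) (suc j) i<j) =
    ∈-++⁺ʳ (map first-asc (allFin r)) (∈-map⁺ suc-asc (ascending-complete (asc i j (ℕ.≤-pred i<j))))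
  ascending-complete {suc r} (asc zero zero p) = ⊥-elim-irr (ℕ.n≮n 0 p)
  ascending-complete {suc r} (asc (suc i) zero p) = ⊥-elim-irr (ℕ.n≮0 p)

  ascending-unique : ∀ r → Unique (ascending r)
  ascending-unique zero    = []
  ascending-unique (suc r) = Unique.++⁺
    (Unique.map⁺ (λ { refl → refl }) (Unique.allFin⁺ r))
    (Unique.map⁺ (λ { {asc _ _ _} {asc _ _ _} refl → refl }) (ascending-unique r))
    disjoint
    where
    disjoint : Disjoint (map first-asc (allFin r)) (map suc-asc (ascending r))
    disjoint (p , q) with ∈-map⁻ first-asc p | ∈-map⁻ suc-asc q
    ... | _ , _ , refl | _ , _ , ()

posRoots-complete : ∀ {r} (α : PosRoot r) → α ∈ posRoots r
posRoots-complete     (short i) = ∈-++⁺ˡ (∈-map⁺ short (∈-allFin i))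
posRoots-complete {r} (minus p) =
  ∈-++⁺ʳ (map short (allFin r)) (∈-++⁺ˡ (∈-map⁺ minus (ascending-complete p)))
posRoots-complete {r} (plus p)  =
  ∈-++⁺ʳ (map short (allFin r)) (∈-++⁺ʳ (map minus (ascending r)) (∈-map⁺ plus (ascending-complete p)))

posRoots-unique : ∀ r → Unique (posRoots r)
posRoots-unique r = Unique.++⁺
  (Unique.map⁺ (λ { refl → refl }) (Unique.allFin⁺ r))
  (Unique.++⁺
    (Unique.map⁺ (λ { refl → refl }) (ascending-unique r))
    (Unique.map⁺ (λ { refl → refl }) (ascending-unique r))
    disjoint₂)
  disjoint₁
  where
  disjoint₂ : Disjoint (map minus (ascending r)) (map plus (ascending r))
  disjoint₂ (p , q) with ∈-map⁻ minus p | ∈-map⁻ plus q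
  ... | _ , _ , refl | _ , _ , ()
  disjoint₁ : Disjoint (map short (allFin r)) (map minus (ascending r) ++ map plus (ascending r))
  disjoint₁ (p , q) with ∈-map⁻ short p | ∈-++⁻ (map minus (ascending r)) q
  ... | _ , _ , refl | inj₁ q′ with _ , _ , () ← ∈-map⁻ minus q′
  ... | _ , _ , refl | inj₂ q′ with _ , _ , () ← ∈-map⁻ plus q′

highestRoot : ∀ r → .{{NonZero r}} → PosRoot r
highestRoot 1             = short zero
highestRoot (suc (suc r)) = plus (asc zero (suc zero) z<s)

highestRoot-maximum : ∀ r .{{_ : NonZero r}} → Maximum _≼_ (highestRoot r)
highestRoot-maximum r α = coords⇒≼ {α = α} {highestRoot r} (subst (ℕ._≤ lower α) (sym (low r)) z≤n) (up r α)
  where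
  low : ∀ r .{{_ : NonZero r}} → lower (highestRoot r) ≡ 0
  low 1             = refl
  low (suc (suc r)) = refl
  up : ∀ r .{{_ : NonZero r}} (α : PosRoot r) → upper α ℕ.≤ upper (highestRoot r)
  up 1 α = ℕ.≤-pred (ℕ.≤-trans (s≤s (ℕ.m≤n+m _ (lower α))) (lower+upper< α))
  up r@(suc (suc r′)) α = ℕ.≤-pred (ℕ.≤-trans (s≤s (ℕ.m≤n+m _ (lower α)))
    (subst (lower α ℕ.+ upper α ℕ.<_) (ℕ.+-suc r (suc r′)) (lower+upper< α)))

Φ⁺B : ∀ r → .{{NonZero r}} → FiniteGradedPoset
Φ⁺B r = record
  { Carrier           = PosRoot r
  ; _≤_               = _≼_
  ; isDecPartialOrder = ≼-isDecPartialOrder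
  ; elements          = posRoots r
  ; elements-complete = posRoots-complete
  ; elements-unique   = posRoots-unique r
  ; rank              = rk
  ; rank-covers       = rk-covers
  ; top               = highestRoot r
  ; top-maximum       = highestRoot-maximum r
  }

------------------------------------------------------------------------
-- Ballot words

data Letter : Set where
  L R : Letter

_≟ᴸ_ : DecidableEquality Letter
L ≟ᴸ L = yes refl
L ≟ᴸ R = no λ ()
R ≟ᴸ L = no λ ()
R ≟ᴸ R = yes refl

count : Letter → List Letter → ℕ
count x w = length (filter (x ≟ᴸ_) w)

Ballot : List Letter → Set
Ballot w = All (λ u → count L u ℕ.≤ count R u) (inits w)

ballot? : U.Decidable Ballot
ballot? w = all? (λ u → count L u ℕ.≤? count R u) (inits w)

𝓑 : ∀ r → List (Vec Letter (2 ℕ.* r ∸ 2))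
𝓑 r = filter (λ w → ballot? (List.reverse (toList w))) (tuples (L ∷ R ∷ []) (2 ℕ.* r ∸ 2))

-- Positions are 0-based, so toℕ gives j − 1.
data StartsL : ∀ {m} → Vec Letter m → Fin m → Set where
  first : ∀ {m} {w : Vec Letter (suc m)} → lookup w zero ≡ L → StartsL w zero
  later : ∀ {m} {w : Vec Letter (suc m)} {j : Fin m} →
          lookup w (suc j) ≡ L → lookup w (inject₁ j) ≡ R → StartsL w (suc j)

startsL? : ∀ {m} (w : Vec Letter m) → U.Decidable (StartsL w)
startsL? w zero    = map′ first (λ { (first p) → p }) (lookup w zero ≟ᴸ L)
startsL? {suc _} w (suc j) = map′ (λ (p , q) → later p q) (λ { (later p q) → p , q })
  (lookup w (suc j) ≟ᴸ L ×-dec lookup w (inject₁ j) ≟ᴸ R)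

D : ∀ {m} → Vec Letter m → List (Fin m)
D {m} w = filter (startsL? w) (allFin m)

{-# OPTIONS --safe #-}

-- Let G (a , b) be the generating function of the weak chains all of whose roots
-- lie below (a , b) in the coordinates (lower , upper). For a root of rank n at
-- (a , b), inclusion–exclusion over the last element gives
--   G (a , b) (1 − qⁿ t) = G (a + 1 , b) + G (a , b − 1) − G (a + 1 , b − 1).
-- A path descending from the highest root by steps L (raising a) and R (lowering
-- b) stays among the roots exactly when its word of steps is ballot; read upwards
-- it is a word of 𝓑 r. Splitting off the first one or two steps shows that the
-- weighted count of these words obeys the recursion of G with the denominator
-- cleared.
module Submission where

open import Defs
open import Level using (0ℓ)
open import Algebra.Bundles using (CommutativeRing; RawRing)
open import Data.Bool.Base using (Bool; true; false; if_then_else_; _∧_)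
open import Data.Fin.Base using (Fin; zero; suc; toℕ; inject₁; fromℕ)
open import Data.Fin.Properties using (toℕ-inject₁; toℕ-fromℕ)
open import Data.Integer.Base as ℤ using (0ℤ)
import Data.Integer.Properties as ℤ
open import Data.List.Base as List using (List; []; _∷_; _++_; length; map; filter; tabulate; allFin; inits; upTo; applyUpTo; concatMap)
open import Data.List.Extrema.Nat using (max≤v⁺; v≤max⁺)
open import Data.List.Membership.Propositional using (_∈_; lose)
open import Data.List.Membership.Propositional.Properties using (∈-map⁺)
import Data.List.Properties as List
open import Data.List.Relation.Unary.All as All using (All; []; _∷_; all?)
import Data.List.Relation.Unary.All.Properties as All
open import Data.List.Relation.Unary.AllPairs using (_∷_)
open import Data.List.Relation.Unary.Any using (here; there)
open import Data.List.Relation.Unary.Unique.Propositional using (Unique)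
open import Data.Nat.Base as ℕ using (ℕ; zero; suc; _∸_; NonZero)
open import Data.Nat.ListAction using (sum)
import Data.Nat.Properties as ℕ
open import Data.Product.Base using (∃; _×_; _,_)
open import Data.Sum.Base using (inj₂)
open import Data.Vec.Base as Vec using (Vec; []; _∷_; _∷ʳ_; lookup; toList)
import Data.Vec.Properties as Vec
open import Data.Vec.Relation.Unary.Linked using (linked?)
open import Function.Base using (_∘_; id)
open import Function.Bundles using (_⇔_; mk⇔)
open import Relation.Binary.Core using (Rel)
open import Relation.Binary.Definitions using (Decidable; DecidableEquality; tri<; tri≈; tri>)
open import Relation.Binary.PropositionalEquality as ≡ using (_≡_; _≗_)
open import Relation.Binary.Structures using (IsDecPartialOrder)
open import Relation.Nullary using (¬_; does; yes; no)
open import Relation.Nullary.Decidable using (dec-true; dec-false; does-⇔)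
import Relation.Unary as U
import Algebra.Definitions.RawSemiring as RawSemiringDefs
import Algebra.Properties.CommutativeSemigroup as CommutativeSemigroupProperties
import Algebra.Properties.Group as GroupProperties
import Algebra.Properties.Ring as RingProperties
import Algebra.Properties.Semiring.Exp as Exp
import Relation.Binary.Reasoning.Setoid as SetoidReasoning

-- Finite sums and formal power series

-- Counted from 0, the position of a letter is the rank of the lower end of its step. So a word of
-- `𝓑 r` carries a factor q^n t at each root of rank n where its upward path turns from R to L, and
-- a factor t if it begins with L. The denominators are indexed alike: passing from rank n - 1 to
-- rank n costs the single factor 1 - q^n t.
--
-- The obstacle is a sign: the recursion of G subtracts G (a + 1 , b - 1), while words are only
-- added. The remedy is to compare G (a + 1 , b) with G (a + 1 , b - 1). Multiplied by the
-- denominator of the former, they differ by the weighted count of the words whose descent from (a ,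
-- b) starts with L. This is proved together with the formula for G, by induction on the rank; the
-- factor 1 - q^n t in excess on G (a + 1 , b - 1) produces the weight of a turn. On the boundary a
-- + b = 2r - 1 the difference vanishes, just as no ballot descent starts with L there.
--
-- No quotient of series is formed: denominators stay multiplied out throughout.

module Sums (R : CommutativeRing 0ℓ 0ℓ) where
  open CommutativeRing R
  open ListOps rawRing public
  open SetoidReasoning setoid
  open CommutativeSemigroupProperties +-commutativeSemigroup using (interchange)

  when : Bool → Carrier → Carrier
  when b x = if b then x else 0#

  when-cong : ∀ b {x y} → x ≈ y → when b x ≈ when b y
  when-cong true  x≈y = x≈y
  when-cong false _   = refl

  when-*ˡ : ∀ b x y → x * when b y ≈ when b (x * y)
  when-*ˡ true  x y = refl
  when-*ˡ false x y = zeroʳ x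

  when-∧ : ∀ b c x → when (b ∧ c) x ≡ when b (when c x)
  when-∧ true  c x = ≡.refl
  when-∧ false c x = ≡.refl

  module _ {A : Set} where
    sum-cong-∈ : ∀ (xs : List A) {f g : A → Carrier} → (∀ {x} → x ∈ xs → f x ≈ g x) → sumOver xs f ≈ sumOver xs g
    sum-cong-∈ []       p = refl
    sum-cong-∈ (x ∷ xs) p = +-cong (p (here ≡.refl)) (sum-cong-∈ xs (p ∘ there))

    sum-cong : ∀ (xs : List A) {f g : A → Carrier} → (∀ x → f x ≈ g x) → sumOver xs f ≈ sumOver xs g
    sum-cong xs p = sum-cong-∈ xs (λ {x} _ → p x)

    sum-0 : ∀ (xs : List A) → sumOver xs (λ _ → 0#) ≈ 0#
    sum-0 []       = refl
    sum-0 (x ∷ xs) = trans (+-identityˡ _) (sum-0 xs)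

    sum-+ : ∀ (xs : List A) (f g : A → Carrier) → sumOver xs (λ x → f x + g x) ≈ sumOver xs f + sumOver xs g
    sum-+ []       f g = sym (+-identityˡ 0#)
    sum-+ (x ∷ xs) f g = trans (+-congˡ (sum-+ xs f g)) (interchange (f x) (g x) _ _)

    sum-*ˡ : ∀ (xs : List A) c (f : A → Carrier) → c * sumOver xs f ≈ sumOver xs (λ x → c * f x)
    sum-*ˡ []       c f = zeroʳ c
    sum-*ˡ (x ∷ xs) c f = trans (distribˡ c (f x) _) (+-congˡ (sum-*ˡ xs c f))

    sum-when : ∀ (xs : List A) b (f : A → Carrier) → sumOver xs (λ x → when b (f x)) ≈ when b (sumOver xs f)
    sum-when xs true  f = refl
    sum-when xs false f = sum-0 xs

    sum-++ : ∀ (xs ys : List A) (f : A → Carrier) → sumOver (xs ++ ys) f ≈ sumOver xs f + sumOver ys f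
    sum-++ []       ys f = sym (+-identityˡ _)
    sum-++ (x ∷ xs) ys f = trans (+-congˡ (sum-++ xs ys f)) (sym (+-assoc (f x) _ _))

    sum-filter : ∀ {P : A → Set} (P? : U.Decidable P) (xs : List A) (f : A → Carrier) →
                 sumOver (filter P? xs) f ≈ sumOver xs (λ x → when (does (P? x)) (f x))
    sum-filter P? []       f = refl
    sum-filter P? (x ∷ xs) f with does (P? x)
    ... | true  = +-congˡ (sum-filter P? xs f)
    ... | false = trans (sum-filter P? xs f) (sym (+-identityˡ _))

    sum-≟ : ∀ (_≟_ : DecidableEquality A) {xs : List A} {x} → Unique xs → x ∈ xs → (f : A → Carrier) →
            sumOver xs (λ y → when (does (x ≟ y)) (f y)) ≈ f x
    sum-≟ _≟_ {y ∷ xs} (y∉xs ∷ u) (here ≡.refl) f = begin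
      when (does (y ≟ y)) (f y) + sumOver xs (λ z → when (does (y ≟ z)) (f z))
        ≈⟨ +-congʳ (reflexive (≡.cong (λ b → when b (f y)) (dec-true (y ≟ y) ≡.refl))) ⟩
      f y + sumOver xs (λ z → when (does (y ≟ z)) (f z))
        ≈⟨ +-congˡ (sum-cong-∈ xs (λ {z} z∈xs →
             reflexive (≡.cong (λ b → when b (f z)) (dec-false (y ≟ z) (All.lookup y∉xs z∈xs))))) ⟩
      f y + sumOver xs (λ _ → 0#) ≈⟨ +-congˡ (sum-0 xs) ⟩
      f y + 0#                    ≈⟨ +-identityʳ (f y) ⟩
      f y                         ∎
    sum-≟ _≟_ {y ∷ xs} {x} (y∉xs ∷ u) (there x∈xs) f = begin
      when (does (x ≟ y)) (f y) + sumOver xs (λ z → when (does (x ≟ z)) (f z))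
        ≈⟨ +-congʳ (reflexive (≡.cong (λ b → when b (f y))
             (dec-false (x ≟ y) (λ x≡y → All.lookup y∉xs x∈xs (≡.sym x≡y))))) ⟩
      0# + sumOver xs (λ z → when (does (x ≟ z)) (f z)) ≈⟨ +-identityˡ _ ⟩
      sumOver xs (λ z → when (does (x ≟ z)) (f z))      ≈⟨ sum-≟ _≟_ u x∈xs f ⟩
      f x ∎

  sum-map : ∀ {A B : Set} (g : A → B) (xs : List A) (f : B → Carrier) →
            sumOver (map g xs) f ≡ sumOver xs (f ∘ g)
  sum-map g []       f = ≡.refl
  sum-map g (x ∷ xs) f = ≡.cong (f (g x) +_) (sum-map g xs f)

  sum-swap : ∀ {A B : Set} (xs : List A) (ys : List B) (f : A → B → Carrier) →
             sumOver xs (λ x → sumOver ys (f x)) ≈ sumOver ys (λ y → sumOver xs (λ x → f x y))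
  sum-swap []       ys f = sym (sum-0 ys)
  sum-swap (x ∷ xs) ys f = trans (+-congˡ (sum-swap xs ys f)) (sym (sum-+ ys (f x) _))

  sum-concatMap : ∀ {A B : Set} (g : A → List B) (xs : List A) (f : B → Carrier) →
                  sumOver (concatMap g xs) f ≈ sumOver xs (λ x → sumOver (g x) f)
  sum-concatMap g []       f = refl
  sum-concatMap g (x ∷ xs) f = trans (sum-++ (g x) _ f) (+-congˡ (sum-concatMap g xs f))

  sum-applyUpTo : ∀ (g h : ℕ → ℕ) n (f : ℕ → Carrier) →
                  sumOver (applyUpTo (g ∘ h) n) f ≡ sumOver (applyUpTo h n) (f ∘ g)
  sum-applyUpTo g h zero    f = ≡.refl
  sum-applyUpTo g h (suc n) f = ≡.cong (f (g (h 0)) +_) (sum-applyUpTo g (h ∘ suc) n f)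

  prod-++ : ∀ {A : Set} (xs ys : List A) (f : A → Carrier) → prodOver (xs ++ ys) f ≈ prodOver xs f * prodOver ys f
  prod-++ []       ys f = sym (*-identityˡ _)
  prod-++ (x ∷ xs) ys f = trans (*-congˡ (prod-++ xs ys f)) (sym (*-assoc (f x) _ _))

  module _ {A : Set} (xs : List A) where
    sum-tuples-∷ : ∀ m (f : Vec A (suc m) → Carrier) →
                   sumOver (tuples xs (suc m)) f ≈ sumOver xs (λ x → sumOver (tuples xs m) (λ ys → f (x ∷ ys)))
    sum-tuples-∷ m f = trans (sum-concatMap _ xs f)
      (sum-cong xs (λ x → reflexive (sum-map (x ∷_) (tuples xs m) f)))

    sum-tuples-∷ʳ : ∀ m (f : Vec A (suc m) → Carrier) →
                    sumOver (tuples xs (suc m)) f ≈ sumOver (tuples xs m) (λ ys → sumOver xs (λ x → f (ys ∷ʳ x)))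
    sum-tuples-∷ʳ zero f = trans (sum-tuples-∷ 0 f) (trans
      (sum-cong xs (λ x → +-identityʳ _)) (sym (+-identityʳ _)))
    sum-tuples-∷ʳ (suc m) f = begin
      sumOver (tuples xs (suc (suc m))) f
        ≈⟨ sum-tuples-∷ (suc m) f ⟩
      sumOver xs (λ x → sumOver (tuples xs (suc m)) (λ ys → f (x ∷ ys)))
        ≈⟨ sum-cong xs (λ x → sum-tuples-∷ʳ m (λ ys → f (x ∷ ys))) ⟩
      sumOver xs (λ x → sumOver (tuples xs m) (λ ys → sumOver xs (λ y → f (x ∷ (ys ∷ʳ y)))))
        ≈⟨ sum-tuples-∷ m (λ ys → sumOver xs (λ y → f (ys ∷ʳ y))) ⟨
      sumOver (tuples xs (suc m)) (λ ys → sumOver xs (λ y → f (ys ∷ʳ y))) ∎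

-- The coefficient ring is arbitrary because the construction is iterated: from ℤ to `ℤ⟦q⟧`, then to
-- `ℤ⟦q⟧⟦t⟧`.
module PowerSeries (R : CommutativeRing 0ℓ 0ℓ) where
  open CommutativeRing R
  open Sums R
  open SetoidReasoning setoid
  open CommutativeSemigroupProperties +-commutativeSemigroup using (x∙yz≈y∙xz)

  private module S = RawRing (rawRing ⟦X⟧)

  *-zero : ∀ f g → (f S.* g) 0 ≈ f 0 * g 0
  *-zero f g = +-identityʳ _

  *-sucˡ : ∀ f g n → (f S.* g) (suc n) ≈ f 0 * g (suc n) + ((f ∘ suc) S.* g) n
  *-sucˡ f g n = +-congˡ (reflexive (sum-applyUpTo suc id (suc n) (λ i → f i * g (suc n ∸ i))))

  *-congˢ : ∀ {f f′ g g′} → f S.≈ f′ → g S.≈ g′ → f S.* g S.≈ f′ S.* g′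
  *-congˢ p q n = sum-cong (upTo (suc n)) (λ i → *-cong (p i) (q (n ∸ i)))

  -- Derived from `*-sucˡ` by induction. With both peelings at hand, commutativity follows by
  -- induction without reversing the range of summation.
  *-sucʳ : ∀ f g n → (f S.* g) (suc n) ≈ f (suc n) * g 0 + (f S.* (g ∘ suc)) n
  *-sucʳ f g zero = begin
    (f S.* g) 1                          ≈⟨ *-sucˡ f g 0 ⟩
    f 0 * g 1 + ((f ∘ suc) S.* g) 0      ≈⟨ +-cong (sym (*-zero f (g ∘ suc))) (*-zero (f ∘ suc) g) ⟩
    (f S.* (g ∘ suc)) 0 + f 1 * g 0      ≈⟨ +-comm _ _ ⟩
    f 1 * g 0 + (f S.* (g ∘ suc)) 0      ∎
  *-sucʳ f g (suc n) = begin
    (f S.* g) (suc (suc n))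
      ≈⟨ *-sucˡ f g (suc n) ⟩
    f 0 * g (suc (suc n)) + ((f ∘ suc) S.* g) (suc n)
      ≈⟨ +-congˡ (*-sucʳ (f ∘ suc) g n) ⟩
    f 0 * g (suc (suc n)) + (f (suc (suc n)) * g 0 + ((f ∘ suc) S.* (g ∘ suc)) n)
      ≈⟨ x∙yz≈y∙xz _ _ _ ⟩
    f (suc (suc n)) * g 0 + (f 0 * g (suc (suc n)) + ((f ∘ suc) S.* (g ∘ suc)) n)
      ≈⟨ +-congˡ (*-sucˡ f (g ∘ suc) n) ⟨
    f (suc (suc n)) * g 0 + (f S.* (g ∘ suc)) (suc n) ∎

  *-commˢ : ∀ f g → f S.* g S.≈ g S.* f
  *-commˢ f g zero    = trans (*-zero f g) (trans (*-comm _ _) (sym (*-zero g f)))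
  *-commˢ f g (suc n) = begin
    (f S.* g) (suc n)                        ≈⟨ *-sucˡ f g n ⟩
    f 0 * g (suc n) + ((f ∘ suc) S.* g) n    ≈⟨ +-cong (*-comm _ _) (*-commˢ (f ∘ suc) g n) ⟩
    g (suc n) * f 0 + (g S.* (f ∘ suc)) n    ≈⟨ *-sucʳ g f n ⟨
    (g S.* f) (suc n)                        ∎

  *-distribʳˢ : ∀ h f g → (f S.+ g) S.* h S.≈ f S.* h S.+ g S.* h
  *-distribʳˢ h f g n = trans
    (sum-cong (upTo (suc n)) (λ i → distribʳ (h (n ∸ i)) (f i) (g i)))
    (sum-+ (upTo (suc n)) _ _)

  *-distribˡˢ : ∀ h f g → h S.* (f S.+ g) S.≈ h S.* f S.+ h S.* g
  *-distribˡˢ h f g n = trans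
    (sum-cong (upTo (suc n)) (λ i → distribˡ (h i) (f (n ∸ i)) (g (n ∸ i))))
    (sum-+ (upTo (suc n)) _ _)

  scale-* : ∀ c f g n → ((λ i → c * f i) S.* g) n ≈ c * (f S.* g) n
  scale-* c f g n = trans
    (sum-cong (upTo (suc n)) (λ i → *-assoc c (f i) (g (n ∸ i))))
    (sym (sum-*ˡ (upTo (suc n)) c _))

  *-assocˢ : ∀ f g h → (f S.* g) S.* h S.≈ f S.* (g S.* h)
  *-assocˢ f g h zero = begin
    ((f S.* g) S.* h) 0    ≈⟨ trans (*-zero (f S.* g) h) (*-congʳ (*-zero f g)) ⟩
    (f 0 * g 0) * h 0      ≈⟨ *-assoc _ _ _ ⟩
    f 0 * (g 0 * h 0)      ≈⟨ trans (*-zero f (g S.* h)) (*-congˡ (*-zero g h)) ⟨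
    (f S.* (g S.* h)) 0    ∎
  *-assocˢ f g h (suc n) = begin
    ((f S.* g) S.* h) (suc n)
      ≈⟨ *-sucˡ (f S.* g) h n ⟩
    (f S.* g) 0 * h (suc n) + (((f S.* g) ∘ suc) S.* h) n
      -- By `*-sucˡ` the shift of a product f g is f 0 times the shift of g, plus the shift of f
      -- times g.
      ≈⟨ +-cong (*-congʳ (*-zero f g)) (*-congˢ {g = h} (*-sucˡ f g) (λ _ → refl) n) ⟩
    (f 0 * g 0) * h (suc n) + (((λ i → f 0 * g (suc i)) S.+ (f ∘ suc) S.* g) S.* h) n
      ≈⟨ +-cong (*-assoc _ _ _) (*-distribʳˢ h (λ i → f 0 * g (suc i)) ((f ∘ suc) S.* g) n) ⟩
    f 0 * (g 0 * h (suc n)) + (((λ i → f 0 * g (suc i)) S.* h) n + (((f ∘ suc) S.* g) S.* h) n)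
      ≈⟨ +-congˡ (+-cong (scale-* (f 0) (g ∘ suc) h n) (*-assocˢ (f ∘ suc) g h n)) ⟩
    f 0 * (g 0 * h (suc n)) + (f 0 * ((g ∘ suc) S.* h) n + ((f ∘ suc) S.* (g S.* h)) n)
      ≈⟨ +-assoc _ _ _ ⟨
    (f 0 * (g 0 * h (suc n)) + f 0 * ((g ∘ suc) S.* h) n) + ((f ∘ suc) S.* (g S.* h)) n
      ≈⟨ +-congʳ (trans (*-congˡ (*-sucˡ g h n)) (distribˡ (f 0) _ _)) ⟨
    f 0 * (g S.* h) (suc n) + ((f ∘ suc) S.* (g S.* h)) n
      ≈⟨ *-sucˡ f (g S.* h) n ⟨
    (f S.* (g S.* h)) (suc n) ∎

  *-zeroˡˢ : ∀ f n → (S.0# S.* f) n ≈ 0#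
  *-zeroˡˢ f n = trans (sum-cong (upTo (suc n)) (λ i → zeroˡ (f (n ∸ i)))) (sum-0 (upTo (suc n)))

  const-* : ∀ c f n → (const rawRing c S.* f) n ≈ c * f n
  const-* c f zero    = *-zero (const rawRing c) f
  const-* c f (suc n) = begin
    (const rawRing c S.* f) (suc n)    ≈⟨ *-sucˡ (const rawRing c) f n ⟩
    c * f (suc n) + (S.0# S.* f) n     ≈⟨ +-congˡ (*-zeroˡˢ f n) ⟩
    c * f (suc n) + 0#                 ≈⟨ +-identityʳ _ ⟩
    c * f (suc n)                      ∎

  *-identityˡˢ : ∀ f → S.1# S.* f S.≈ f
  *-identityˡˢ f n = trans (const-* 1# f n) (*-identityˡ (f n))

  const-homo-* : ∀ c d → const rawRing (c * d) S.≈ const rawRing c S.* const rawRing d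
  const-homo-* c d zero    = sym (const-* c (const rawRing d) 0)
  const-homo-* c d (suc n) = sym (trans (const-* c (const rawRing d) (suc n)) (zeroʳ c))

  const-cong : ∀ {c d} → c ≈ d → const rawRing c S.≈ const rawRing d
  const-cong p zero    = p
  const-cong p (suc n) = refl

  indeterminate-*-zero : ∀ f → (indeterminate rawRing S.* f) 0 ≈ 0#
  indeterminate-*-zero f = trans (*-zero (indeterminate rawRing) f) (zeroˡ (f 0))

  indeterminate-*-suc : ∀ f n → (indeterminate rawRing S.* f) (suc n) ≈ f n
  indeterminate-*-suc f n = begin
    (indeterminate rawRing S.* f) (suc n)
      ≈⟨ *-sucˡ (indeterminate rawRing) f n ⟩
    0# * f (suc n) + ((indeterminate rawRing ∘ suc) S.* f) n
      ≈⟨ +-cong (zeroˡ _) (*-congˢ {g = f} tail≈1 (λ _ → refl) n) ⟩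
    0# + (S.1# S.* f) n
      ≈⟨ trans (+-identityˡ _) (*-identityˡˢ f n) ⟩
    f n ∎
    where
    tail≈1 : (indeterminate rawRing ∘ suc) S.≈ S.1#
    tail≈1 zero    = refl
    tail≈1 (suc n) = refl

  commutativeRing : CommutativeRing 0ℓ 0ℓ
  commutativeRing = record
    { Carrier = S.Carrier ; _≈_ = S._≈_ ; _+_ = S._+_ ; _*_ = S._*_ ; -_ = S.-_ ; 0# = S.0# ; 1# = S.1#
    ; isCommutativeRing = record
      { isRing = record
        { +-isAbelianGroup = record
          { isGroup = record
            { isMonoid = record
              { isSemigroup = record
                { isMagma = record
                  { isEquivalence = record
                    { refl  = λ _ → refl
                    ; sym   = λ p n → sym (p n)
                    ; trans = λ p q n → trans (p n) (q n)
                    }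
                  ; ∙-cong = λ p q n → +-cong (p n) (q n)
                  }
                ; assoc = λ f g h n → +-assoc (f n) (g n) (h n)
                }
              ; identity = (λ f n → +-identityˡ (f n)) , (λ f n → +-identityʳ (f n))
              }
            ; inverse = (λ f n → -‿inverseˡ (f n)) , (λ f n → -‿inverseʳ (f n))
            ; ⁻¹-cong = λ p n → -‿cong (p n)
            }
          ; comm = λ f g n → +-comm (f n) (g n)
          }
        ; *-cong = λ {f} {f′} {g} {g′} → *-congˢ {f} {f′} {g} {g′}
        ; *-assoc = *-assocˢ
        ; *-identity = *-identityˡˢ , λ f n → trans (*-commˢ f S.1# n) (*-identityˡˢ f n)
        ; distrib = *-distribˡˢ , *-distribʳˢ
        }
      ; *-comm = *-commˢ
      }
    }

-- Weak chains

module ChainSums (R : CommutativeRing 0ℓ 0ℓ) {A : Set} {_≤_ : Rel A 0ℓ} (_≤?_ : Decidable _≤_)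
                 (xs : List A) (w : A → CommutativeRing.Carrier R) where
  open CommutativeRing R
  open Sums R
  open SetoidReasoning setoid
  open CommutativeSemigroupProperties *-commutativeSemigroup using (x∙yz≈y∙xz)

  weight : ∀ {m} → Vec A m → Carrier
  weight []      = 1#
  weight (x ∷ v) = w x * weight v

  -- Weighted chains of m elements that may follow x, split by their first element, the direction in
  -- which `tuples` and `linked?` recurse.
  above : ℕ → A → Carrier
  above zero    x = 1#
  above (suc m) x = sumOver xs (λ y → when (does (x ≤? y)) (w y * above m y))

  -- Weighted chains split by their last element instead, as inclusion-exclusion requires. The
  -- predicate constrains that last element; each remaining element lies below its successor.
  below : ℕ → (A → Bool) → Carrier
  below zero    p = 1#
  below (suc m) p = sumOver xs (λ y → when (p y) (w y * below m (λ x → does (x ≤? y))))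

  ↓_ : A → A → Bool
  (↓ y) x = does (x ≤? y)

  below-cong : ∀ m {p q} → p ≗ q → below m p ≈ below m q
  below-cong zero    p≗q = refl
  below-cong (suc m) p≗q = sum-cong xs (λ y → reflexive (≡.cong (λ b → when b _) (p≗q y)))

  below-∅ : ∀ m {p} → (∀ y → p y ≡ false) → below (suc m) p ≈ 0#
  below-∅ m p≡∅ = trans (sum-cong xs (λ y → reflexive (≡.cong (λ b → when b _) (p≡∅ y)))) (sum-0 xs)

  above-chains : ∀ m x → sumOver (tuples xs m) (λ v → when (does (linked? _≤?_ (x ∷ v))) (weight v)) ≈ above m x
  above-chains zero    x = +-identityʳ 1#
  above-chains (suc m) x = begin
    sumOver (tuples xs (suc m)) (λ v → when (does (linked? _≤?_ (x ∷ v))) (weight v))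
      ≈⟨ sum-tuples-∷ xs m _ ⟩
    sumOver xs (λ y → sumOver (tuples xs m) (λ v →
      when (does (x ≤? y) ∧ does (linked? _≤?_ (y ∷ v))) (w y * weight v)))
      ≈⟨ sum-cong xs first-step ⟩
    above (suc m) x ∎
    where
    first-step : ∀ y → sumOver (tuples xs m) (λ v → when (does (x ≤? y) ∧ does (linked? _≤?_ (y ∷ v))) (w y * weight v)) ≈
                       when (does (x ≤? y)) (w y * above m y)
    first-step y = begin
      sumOver (tuples xs m) (λ v → when (does (x ≤? y) ∧ does (linked? _≤?_ (y ∷ v))) (w y * weight v))
        ≈⟨ sum-cong (tuples xs m) (λ v → trans
             (reflexive (when-∧ (does (x ≤? y)) (does (linked? _≤?_ (y ∷ v))) _))
             (when-cong (does (x ≤? y)) (sym (when-*ˡ (does (linked? _≤?_ (y ∷ v))) (w y) (weight v))))) ⟩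
      sumOver (tuples xs m) (λ v → when (does (x ≤? y)) (w y * when (does (linked? _≤?_ (y ∷ v))) (weight v)))
        ≈⟨ sum-when (tuples xs m) (does (x ≤? y)) _ ⟩
      when (does (x ≤? y)) (sumOver (tuples xs m) (λ v → w y * when (does (linked? _≤?_ (y ∷ v))) (weight v)))
        ≈⟨ when-cong (does (x ≤? y)) (trans (sym (sum-*ˡ (tuples xs m) (w y) _)) (*-congˡ (above-chains m y))) ⟩
      when (does (x ≤? y)) (w y * above m y) ∎

  -- Both sides sum over the chains of m + n + 2 elements with one element marked; the mark moves
  -- from x to its successor y.
  above-below : ∀ m n → sumOver xs (λ x → w x * (above (suc m) x * below n (↓ x))) ≈
                        sumOver xs (λ x → w x * (above m x * below (suc n) (↓ x)))
  above-below m n = begin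
    sumOver xs (λ x → w x * (above (suc m) x * below n (↓ x)))
      ≈⟨ sum-cong xs expandˡ ⟩
    sumOver xs (λ x → sumOver xs (λ y → when (does (x ≤? y)) (w x * ((w y * above m y) * below n (↓ x)))))
      ≈⟨ sum-swap xs xs _ ⟩
    sumOver xs (λ y → sumOver xs (λ x → when (does (x ≤? y)) (w x * ((w y * above m y) * below n (↓ x)))))
      ≈⟨ sum-cong xs (λ y → sum-cong xs (λ x → when-cong (does (x ≤? y)) (rearrange (w x) (w y) _ _))) ⟩
    sumOver xs (λ y → sumOver xs (λ x → when (does (x ≤? y)) (w y * (above m y * (w x * below n (↓ x))))))
      ≈⟨ sum-cong xs expandʳ ⟨
    sumOver xs (λ y → w y * (above m y * below (suc n) (↓ y))) ∎
    where
    rearrange : ∀ a b c d → a * ((b * c) * d) ≈ b * (c * (a * d))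
    rearrange a b c d = begin
      a * ((b * c) * d)   ≈⟨ x∙yz≈y∙xz a (b * c) d ⟩
      (b * c) * (a * d)   ≈⟨ *-assoc b c (a * d) ⟩
      b * (c * (a * d))   ∎

    expandˡ : ∀ x → w x * (above (suc m) x * below n (↓ x)) ≈
              sumOver xs (λ y → when (does (x ≤? y)) (w x * ((w y * above m y) * below n (↓ x))))
    expandˡ x = begin
      w x * (above (suc m) x * below n (↓ x))
        ≈⟨ *-congˡ (trans (*-comm _ _) (trans (sum-*ˡ xs _ _) (sum-cong xs (λ y →
             trans (when-*ˡ (does (x ≤? y)) _ _) (when-cong (does (x ≤? y)) (*-comm _ _)))))) ⟩
      w x * sumOver xs (λ y → when (does (x ≤? y)) ((w y * above m y) * below n (↓ x)))
        ≈⟨ trans (sum-*ˡ xs _ _) (sum-cong xs (λ y → when-*ˡ (does (x ≤? y)) _ _)) ⟩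
      sumOver xs (λ y → when (does (x ≤? y)) (w x * ((w y * above m y) * below n (↓ x)))) ∎

    expandʳ : ∀ y → w y * (above m y * below (suc n) (↓ y)) ≈
              sumOver xs (λ x → when (does (x ≤? y)) (w y * (above m y * (w x * below n (↓ x)))))
    expandʳ y = begin
      w y * (above m y * below (suc n) (↓ y))
        ≈⟨ *-congˡ (trans (sum-*ˡ xs _ _) (sum-cong xs (λ x → when-*ˡ (does (x ≤? y)) _ _))) ⟩
      w y * sumOver xs (λ x → when (does (x ≤? y)) (above m y * (w x * below n (↓ x))))
        ≈⟨ trans (sum-*ˡ xs _ _) (sum-cong xs (λ x → when-*ˡ (does (x ≤? y)) _ _)) ⟩
      sumOver xs (λ x → when (does (x ≤? y)) (w y * (above m y * (w x * below n (↓ x))))) ∎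

  above-below-shift : ∀ m n → sumOver xs (λ x → w x * (above m x * below n (↓ x))) ≈
                              sumOver xs (λ x → w x * (1# * below (m ℕ.+ n) (↓ x)))
  above-below-shift zero    n = refl
  above-below-shift (suc m) n = begin
    sumOver xs (λ x → w x * (above (suc m) x * below n (↓ x)))    ≈⟨ above-below m n ⟩
    sumOver xs (λ x → w x * (above m x * below (suc n) (↓ x)))    ≈⟨ above-below-shift m (suc n) ⟩
    sumOver xs (λ x → w x * (1# * below (m ℕ.+ suc n) (↓ x)))
      ≡⟨ ≡.cong (λ k → sumOver xs (λ x → w x * (1# * below k (↓ x)))) (ℕ.+-suc m n) ⟩
    sumOver xs (λ x → w x * (1# * below (suc m ℕ.+ n) (↓ x)))     ∎

  chains-below : ∀ m → sumOver (filter (linked? _≤?_) (tuples xs m)) weight ≈ below m (λ _ → true)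
  chains-below zero    = +-identityʳ 1#
  chains-below (suc m) = begin
    sumOver (filter (linked? _≤?_) (tuples xs (suc m))) weight
      ≈⟨ sum-filter (linked? _≤?_) (tuples xs (suc m)) weight ⟩
    sumOver (tuples xs (suc m)) (λ v → when (does (linked? _≤?_ v)) (weight v))
      ≈⟨ sum-tuples-∷ xs m _ ⟩
    sumOver xs (λ x → sumOver (tuples xs m) (λ v → when (does (linked? _≤?_ (x ∷ v))) (w x * weight v)))
      ≈⟨ sum-cong xs (λ x → trans
           (sum-cong (tuples xs m) (λ v → sym (when-*ˡ (does (linked? _≤?_ (x ∷ v))) (w x) (weight v))))
           (trans (sym (sum-*ˡ (tuples xs m) (w x) _)) (*-congˡ (above-chains m x)))) ⟩
    sumOver xs (λ x → w x * above m x)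
      ≈⟨ sum-cong xs (λ x → *-congˡ (*-identityʳ _)) ⟨
    sumOver xs (λ x → w x * (above m x * 1#))
      -- The mark travels from the first element of the chain to the last.
      ≈⟨ above-below-shift m 0 ⟩
    sumOver xs (λ x → w x * (1# * below (m ℕ.+ 0) (↓ x)))
      ≈⟨ sum-cong xs (λ x → *-congˡ (trans (*-identityˡ _)
           (reflexive (≡.cong (λ k → below k (↓ x)) (ℕ.+-identityʳ m))))) ⟩
    below (suc m) (λ _ → true) ∎

-- Inclusion-exclusion over the last root of a chain

-- The possible joint truth values of a ≤ l, a + 1 ≤ l, a ≡ l, and of the dual
-- conditions u ≤ b + 1, u ≤ b, b + 1 ≡ u.
data Split : Bool → Bool → Bool → Set where
  outside  : Split false false false
  boundary : Split true  false true
  interior : Split true  true  false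

split-lower : ∀ a l → Split (does (a ℕ.≤? l)) (does (suc a ℕ.≤? l)) (does (a ℕ.≟ l))
split-lower a l with ℕ.<-cmp a l
... | tri< a<l a≢l _
  rewrite dec-true (a ℕ.≤? l) (ℕ.<⇒≤ a<l) | dec-true (suc a ℕ.≤? l) a<l | dec-false (a ℕ.≟ l) a≢l = interior
... | tri≈ a≮l a≡l _
  rewrite dec-true (a ℕ.≤? l) (ℕ.≤-reflexive a≡l)
        | dec-false (suc a ℕ.≤? l) a≮l | dec-true (a ℕ.≟ l) a≡l = boundary
... | tri> a≮l a≢l l<a
  rewrite dec-false (a ℕ.≤? l) (ℕ.<⇒≱ l<a)
        | dec-false (suc a ℕ.≤? l) a≮l | dec-false (a ℕ.≟ l) a≢l = outside

split-upper : ∀ b u → Split (does (u ℕ.≤? suc b)) (does (u ℕ.≤? b)) (does (suc b ℕ.≟ u))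
split-upper b u with ℕ.<-cmp (suc b) u
... | tri< b<u b≢u _
  rewrite dec-false (u ℕ.≤? suc b) (ℕ.<⇒≱ b<u)
        | dec-false (u ℕ.≤? b) (ℕ.<⇒≱ (ℕ.<-trans (ℕ.n<1+n b) b<u))
        | dec-false (suc b ℕ.≟ u) b≢u = outside
... | tri≈ _ b≡u _
  rewrite dec-true (u ℕ.≤? suc b) (ℕ.≤-reflexive (≡.sym b≡u))
        | dec-false (u ℕ.≤? b) (ℕ.<⇒≱ (ℕ.≤-reflexive b≡u))
        | dec-true (suc b ℕ.≟ u) b≡u = boundary
... | tri> _ b≢u u<b
  rewrite dec-true (u ℕ.≤? suc b) (ℕ.<⇒≤ u<b)
        | dec-true (u ℕ.≤? b) (ℕ.≤-pred u<b)
        | dec-false (suc b ℕ.≟ u) b≢u = interior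

-- The region below (a , b), defined also for pairs that are not coordinates of a root, as occur at
-- the edges of the recursion. At the coordinates of a root α it computes to the decision of y ≼ α,
-- so `below` unfolds into sums over such regions.
inside : ∀ {r} → ℕ → ℕ → PosRoot r → Bool
inside a b y = does (a ℕ.≤? lower y) ∧ does (upper y ℕ.≤? b)

inside-∅ : ∀ {r} a b → b ℕ.≤ a → (y : PosRoot r) → inside a b y ≡ false
inside-∅ a b b≤a y with a ℕ.≤? lower y
... | no a≰l rewrite dec-false (a ℕ.≤? lower y) a≰l = ≡.refl
... | yes a≤l rewrite dec-true (a ℕ.≤? lower y) a≤l =
  dec-false (upper y ℕ.≤? b) (ℕ.<⇒≱ (ℕ.≤-<-trans (ℕ.≤-trans b≤a a≤l) (lower<upper y)))

-- The pair (0 , 2r - 1) is the coordinate pair of the highest root.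
inside-⊤ : ∀ {r} a b → a ≡ 0 → r ℕ.+ r ≡ suc b → (y : PosRoot r) → true ≡ inside a b y
inside-⊤ {r} a b a≡0 r+r≡ y
  rewrite dec-true (a ℕ.≤? lower y) (≡.subst (ℕ._≤ lower y) (≡.sym a≡0) ℕ.z≤n)
        | dec-true (upper y ℕ.≤? b) (ℕ.≤-pred (ℕ.≤-<-trans (ℕ.m≤n+m _ (lower y))
            (≡.subst (lower y ℕ.+ upper y ℕ.<_) r+r≡ (lower+upper< y)))) = ≡.refl

-- Coordinates of a root sum to less than 2r, and a + (b + 1) is already 2r; hence a root with lower
-- coordinate at least a has upper coordinate at most b.
inside-diagonal : ∀ {r} a b → r ℕ.+ r ≡ a ℕ.+ suc b → (y : PosRoot r) → inside a (suc b) y ≡ inside a b y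
inside-diagonal {r} a b r+r≡ y with a ℕ.≤? lower y
... | no a≰l rewrite dec-false (a ℕ.≤? lower y) a≰l = ≡.refl
... | yes a≤l rewrite dec-true (a ℕ.≤? lower y) a≤l =
  ≡.trans (dec-true (upper y ℕ.≤? suc b) (ℕ.m≤n⇒m≤1+n u≤b)) (≡.sym (dec-true (upper y ℕ.≤? b) u≤b))
  where
  u≤b : upper y ℕ.≤ b
  u≤b = ℕ.≤-pred (ℕ.+-cancelˡ-< a _ _ (ℕ.≤-<-trans (ℕ.+-monoˡ-≤ (upper y) a≤l)
    (≡.subst (lower y ℕ.+ upper y ℕ.<_) r+r≡ (lower+upper< y))))

module RootChains (R : CommutativeRing 0ℓ 0ℓ) (r : ℕ) (w : PosRoot r → CommutativeRing.Carrier R) where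
  open CommutativeRing R
  open Sums R
  open SetoidReasoning setoid
  open IsDecPartialOrder (≼-isDecPartialOrder {r}) using (_≤?_; _≟_)
  open ChainSums R _≤?_ (posRoots r) w public using (below; below-∅; below-cong; chains-below; weight)

  -- `Split` says p = p′ + p″ for indicators, so this is the expansion of (p - p′)(q - q′) = p″ q″.
  when-split : ∀ {p p′ p″ q q′ q″} → Split p p′ p″ → Split q q′ q″ → ∀ x →
               when (p ∧ q) x + when (p′ ∧ q′) x ≈ (when (p′ ∧ q) x + when (p ∧ q′) x) + when (p″ ∧ q″) x
  when-split outside  _        x = sym (+-identityʳ _)
  when-split boundary outside  x = sym (+-identityʳ _)
  when-split boundary boundary x = trans (+-comm _ _) (+-congʳ (sym (+-identityˡ _)))
  when-split boundary interior x = trans (+-comm _ _) (sym (+-identityʳ _))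
  when-split interior outside  x = sym (+-identityʳ _)
  when-split interior boundary x = sym (+-identityʳ _)
  when-split interior interior x = sym (+-identityʳ _)

  below-inclusion-exclusion : ∀ m (α : PosRoot r) b → upper α ≡ suc b → let a = lower α in
    below (suc m) (inside a (suc b)) + below (suc m) (inside (suc a) b) ≈
    (below (suc m) (inside (suc a) (suc b)) + below (suc m) (inside a b)) + w α * below m (inside a (suc b))
  below-inclusion-exclusion m α b u≡ = begin
    Σ⟨ inside a (suc b) ⟩ + Σ⟨ inside (suc a) b ⟩
      ≈⟨ sum-+ (posRoots r) (term (inside a (suc b))) (term (inside (suc a) b)) ⟨
    sumOver (posRoots r) (λ y → term (inside a (suc b)) y + term (inside (suc a) b) y)
      ≈⟨ sum-cong (posRoots r) (λ y → when-split (split-lower a (lower y)) (split-upper b (upper y)) (f y)) ⟩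
    sumOver (posRoots r) (λ y → (term (inside (suc a) (suc b)) y + term (inside a b) y) + term at-α y)
      ≈⟨ trans (sum-+ (posRoots r) _ (term at-α))
               (+-congʳ (sum-+ (posRoots r) (term (inside (suc a) (suc b))) (term (inside a b)))) ⟩
    (Σ⟨ inside (suc a) (suc b) ⟩ + Σ⟨ inside a b ⟩) + Σ⟨ at-α ⟩
      -- With `suc b` replaced by `upper α`, the predicate `at-α y` computes to `does (α ≟ y)`, so
      -- the sum collapses to its term at `α`.
      ≈⟨ +-congˡ (trans
           (sum-cong (posRoots r) (λ y → reflexive
             (≡.cong (λ c → when (does (a ℕ.≟ lower y) ∧ does (c ℕ.≟ upper y)) (f y)) (≡.sym u≡))))
           (sum-≟ _≟_ (posRoots-unique r) (posRoots-complete α) f)) ⟩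
    (Σ⟨ inside (suc a) (suc b) ⟩ + Σ⟨ inside a b ⟩) + w α * below m (inside a (upper α))
      ≡⟨ ≡.cong (λ c → (Σ⟨ inside (suc a) (suc b) ⟩ + Σ⟨ inside a b ⟩) + w α * below m (inside a c)) u≡ ⟩
    (Σ⟨ inside (suc a) (suc b) ⟩ + Σ⟨ inside a b ⟩) + w α * below m (inside a (suc b)) ∎
    where
    a : ℕ
    a = lower α
    f : PosRoot r → Carrier
    f y = w y * below m (inside (lower y) (upper y))
    term : (PosRoot r → Bool) → PosRoot r → Carrier
    term p y = when (p y) (f y)
    Σ⟨_⟩ : (PosRoot r → Bool) → Carrier
    Σ⟨ p ⟩ = sumOver (posRoots r) (term p)
    at-α : PosRoot r → Bool
    at-α y = does (a ℕ.≟ lower y) ∧ does (suc b ℕ.≟ upper y)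

-- Ballot words

-- The allowance `s` records letters R already read, so that letters can be removed from the front
-- one at a time. For `s = 0` it unfolds to `Ballot`.
BallotFrom : ℕ → List Letter → Set
BallotFrom s w = All (λ u → count L u ℕ.≤ s ℕ.+ count R u) (inits w)

ballotFrom? : ∀ s → U.Decidable (BallotFrom s)
ballotFrom? s w = all? (λ u → count L u ℕ.≤? s ℕ.+ count R u) (inits w)

ballotFrom-R : ∀ s w → BallotFrom s (R ∷ w) ⇔ BallotFrom (suc s) w
ballotFrom-R s w = mk⇔
  (λ { (_ ∷ ps) → All.map (λ {u} p → ≡.subst (count L u ℕ.≤_) (ℕ.+-suc s (count R u)) p) (All.map⁻ ps) })
  (λ ps → ℕ.z≤n ∷ All.map⁺ (All.map (λ {u} p → ≡.subst (count L u ℕ.≤_) (≡.sym (ℕ.+-suc s (count R u))) p) ps))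

ballotFrom-L : ∀ s w → BallotFrom (suc s) (L ∷ w) ⇔ BallotFrom s w
ballotFrom-L s w = mk⇔
  (λ { (_ ∷ ps) → All.map ℕ.≤-pred (All.map⁻ ps) })
  (λ ps → ℕ.z≤n ∷ All.map⁺ (All.map ℕ.s≤s ps))

¬ballotFrom-0-L : ∀ w → ¬ BallotFrom 0 (L ∷ w)
¬ballotFrom-0-L w (_ ∷ () ∷ _)

reverse-∷ʳ : ∀ {m} (w : Vec Letter m) c → List.reverse (toList (w ∷ʳ c)) ≡ c ∷ List.reverse (toList w)
reverse-∷ʳ w c = ≡.trans (≡.cong List.reverse (Vec.toList-∷ʳ c w)) (List.reverse-++ (toList w) (c ∷ []))

module _ {A : Set} where
  lookup-∷ʳ-inject₁ : ∀ {m} (v : Vec A m) x i → lookup (v ∷ʳ x) (inject₁ i) ≡ lookup v i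
  lookup-∷ʳ-inject₁ (y ∷ v) x zero    = ≡.refl
  lookup-∷ʳ-inject₁ (y ∷ v) x (suc i) = lookup-∷ʳ-inject₁ v x i

  lookup-∷ʳ-fromℕ : ∀ {m} (v : Vec A m) x → lookup (v ∷ʳ x) (fromℕ m) ≡ x
  lookup-∷ʳ-fromℕ []      x = ≡.refl
  lookup-∷ʳ-fromℕ (y ∷ v) x = lookup-∷ʳ-fromℕ v x

  tabulate-∷ʳ : ∀ {m} (f : Fin (suc m) → A) → tabulate f ≡ tabulate (f ∘ inject₁) ++ f (fromℕ m) ∷ []
  tabulate-∷ʳ {zero}  f = ≡.refl
  tabulate-∷ʳ {suc m} f = ≡.cong (f zero ∷_) (tabulate-∷ʳ (f ∘ suc))

  filter-map : ∀ {B : Set} {P : A → Set} {Q : B → Set} (P? : U.Decidable P) (Q? : U.Decidable Q) (f : B → A) →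
               (∀ y → does (P? (f y)) ≡ does (Q? y)) → ∀ ys → filter P? (map f ys) ≡ map f (filter Q? ys)
  filter-map P? Q? f p []       = ≡.refl
  filter-map P? Q? f p (y ∷ ys) with does (P? (f y)) | does (Q? y) | p y
  ... | true  | _ | ≡.refl = ≡.cong (f y ∷_) (filter-map P? Q? f p ys)
  ... | false | _ | ≡.refl = filter-map P? Q? f p ys

startsL-∷ʳ-inject₁ : ∀ {m} (w : Vec Letter m) c i → StartsL (w ∷ʳ c) (inject₁ i) ⇔ StartsL w i
startsL-∷ʳ-inject₁ (x ∷ w) c zero    = mk⇔ (λ { (first p) → first p }) (λ { (first p) → first p })
startsL-∷ʳ-inject₁ (x ∷ w) c (suc i) = mk⇔
  (λ { (later p q) → later (≡.trans (≡.sym (lookup-∷ʳ-inject₁ w c i)) p)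
                           (≡.trans (≡.sym (lookup-∷ʳ-inject₁ (x ∷ w) c (inject₁ i))) q) })
  (λ { (later p q) → later (≡.trans (lookup-∷ʳ-inject₁ w c i) p)
                           (≡.trans (lookup-∷ʳ-inject₁ (x ∷ w) c (inject₁ i)) q) })

startsL-lookup : ∀ {m} {w : Vec Letter m} {i} → StartsL w i → lookup w i ≡ L
startsL-lookup (first p)   = p
startsL-lookup (later p _) = p

¬startsL-R : ∀ {m} (w : Vec Letter m) → ¬ StartsL (w ∷ʳ R) (fromℕ m)
¬startsL-R w p with () ← ≡.trans (≡.sym (startsL-lookup p)) (lookup-∷ʳ-fromℕ w R)

¬startsL-LL : ∀ {m} (w : Vec Letter m) → ¬ StartsL (w ∷ʳ L ∷ʳ L) (fromℕ (suc m))
¬startsL-LL {m} w (later _ q)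
  with () ← ≡.trans (≡.sym q) (≡.trans (lookup-∷ʳ-inject₁ (w ∷ʳ L) L (fromℕ m)) (lookup-∷ʳ-fromℕ w L))

startsL-RL : ∀ {m} (w : Vec Letter m) → StartsL (w ∷ʳ R ∷ʳ L) (fromℕ (suc m))
startsL-RL {m} w = go (w ∷ʳ R) (lookup-∷ʳ-fromℕ w R)
  where
  go : ∀ (v : Vec Letter (suc m)) → lookup v (fromℕ m) ≡ R → StartsL (v ∷ʳ L) (fromℕ (suc m))
  go (x ∷ v) p = later (lookup-∷ʳ-fromℕ v L) (≡.trans (lookup-∷ʳ-inject₁ (x ∷ v) L (fromℕ m)) p)

-- Membership in `D` depends only on a letter and its predecessor, so appending `c` leaves the
-- earlier positions as they were. Mapping by `toℕ` makes positions in `Fin m` and `Fin (suc m)`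
-- comparable.
D-∷ʳ : ∀ {m} (w : Vec Letter m) c →
       map toℕ (D (w ∷ʳ c)) ≡ map toℕ (D w) ++ (if does (startsL? (w ∷ʳ c) (fromℕ m)) then m ∷ [] else [])
D-∷ʳ {m} w c = begin
  map toℕ (filter P? (allFin (suc m)))
    ≡⟨ ≡.cong (map toℕ ∘ filter P?) (≡.trans (tabulate-∷ʳ id)
         (≡.cong (_++ fromℕ m ∷ []) (≡.sym (List.map-tabulate id inject₁)))) ⟩
  map toℕ (filter P? (map inject₁ (allFin m) ++ fromℕ m ∷ []))
    ≡⟨ ≡.cong (map toℕ) (List.filter-++ P? (map inject₁ (allFin m)) _) ⟩
  map toℕ (filter P? (map inject₁ (allFin m)) ++ filter P? (fromℕ m ∷ []))
    ≡⟨ List.map-++ toℕ (filter P? (map inject₁ (allFin m))) _ ⟩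
  map toℕ (filter P? (map inject₁ (allFin m))) ++ map toℕ (filter P? (fromℕ m ∷ []))
    ≡⟨ ≡.cong₂ _++_ front back ⟩
  map toℕ (D w) ++ (if does (P? (fromℕ m)) then m ∷ [] else []) ∎
  where
  open ≡.≡-Reasoning
  P? : U.Decidable (StartsL (w ∷ʳ c))
  P? = startsL? (w ∷ʳ c)
  front : map toℕ (filter P? (map inject₁ (allFin m))) ≡ map toℕ (D w)
  front = ≡.trans
    (≡.cong (map toℕ) (filter-map P? (startsL? w) inject₁
      (λ i → does-⇔ (startsL-∷ʳ-inject₁ w c i) (P? (inject₁ i)) (startsL? w i)) (allFin m)))
    (≡.trans (≡.sym (List.map-∘ (D w))) (List.map-cong toℕ-inject₁ (D w)))
  back : map toℕ (filter P? (fromℕ m ∷ [])) ≡ (if does (P? (fromℕ m)) then m ∷ [] else [])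
  back with does (P? (fromℕ m))
  ... | true  = ≡.cong (_∷ []) (toℕ-fromℕ m)
  ... | false = ≡.refl

D-∷ʳ-end : ∀ {m} (w : Vec Letter m) c → ¬ StartsL (w ∷ʳ c) (fromℕ m) → map toℕ (D (w ∷ʳ c)) ≡ map toℕ (D w)
D-∷ʳ-end {m} w c ¬p = ≡.trans (D-∷ʳ w c) (≡.trans
  (≡.cong (λ b → map toℕ (D w) ++ (if b then m ∷ [] else [])) (dec-false (startsL? (w ∷ʳ c) (fromℕ m)) ¬p))
  (List.++-identityʳ _))

D-∷ʳ-start : ∀ {m} (w : Vec Letter m) c → StartsL (w ∷ʳ c) (fromℕ m) → map toℕ (D (w ∷ʳ c)) ≡ map toℕ (D w) ++ m ∷ []
D-∷ʳ-start {m} w c p = ≡.trans (D-∷ʳ w c)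
  (≡.cong (λ b → map toℕ (D w) ++ (if b then m ∷ [] else [])) (dec-true (startsL? (w ∷ʳ c) (fromℕ m)) p))

module Words (T : CommutativeRing 0ℓ 0ℓ) (z : ℕ → CommutativeRing.Carrier T) where
  open CommutativeRing T
  open Sums T
  open SetoidReasoning setoid

  letters : List Letter
  letters = L ∷ R ∷ []

  weight : ∀ {m} → Vec Letter m → Carrier
  weight w = prodOver (map toℕ (D w)) z

  weight-end : ∀ {m} (w : Vec Letter m) c → ¬ StartsL (w ∷ʳ c) (fromℕ m) → weight (w ∷ʳ c) ≈ weight w
  weight-end w c ¬p = reflexive (≡.cong (λ ns → prodOver ns z) (D-∷ʳ-end w c ¬p))

  weight-start : ∀ {m} (w : Vec Letter m) c → StartsL (w ∷ʳ c) (fromℕ m) → weight (w ∷ʳ c) ≈ z m * weight w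
  weight-start {m} w c p = begin
    weight (w ∷ʳ c)                                ≡⟨ ≡.cong (λ ns → prodOver ns z) (D-∷ʳ-start w c p) ⟩
    prodOver (map toℕ (D w) ++ m ∷ []) z           ≈⟨ prod-++ (map toℕ (D w)) (m ∷ []) z ⟩
    weight w * (z m * 1#)                          ≈⟨ trans (*-congˡ (*-identityʳ (z m))) (*-comm _ _) ⟩
    z m * weight w                                 ∎

  rev : ∀ {m} → Vec Letter m → List Letter
  rev w = List.reverse (toList w)

  -- W n s sums over the words of length n whose reversal stays ballot after a
  -- head start of s letters R; V n s is the part of W (suc n) s from the words
  -- ending in L.
  W V : ℕ → ℕ → Carrier
  W n s = sumOver (tuples letters n) (λ w → when (does (ballotFrom? s (rev w))) (weight w))
  V n s = sumOver (tuples letters n) (λ w → when (does (ballotFrom? s (L ∷ rev w))) (weight (w ∷ʳ L)))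

  sum-letters : ∀ (f : Letter → Carrier) → sumOver letters f ≈ f L + f R
  sum-letters f = +-congˡ (+-identityʳ _)

  when-R : ∀ {m} s (w : Vec Letter m) {x y} → x ≈ y →
           when (does (ballotFrom? s (R ∷ rev w))) x ≈ when (does (ballotFrom? (suc s) (rev w))) y
  when-R s w {x} x≈y = trans
    (reflexive (≡.cong (λ b → when b x)
      (does-⇔ (ballotFrom-R s (rev w)) (ballotFrom? s (R ∷ rev w)) (ballotFrom? (suc s) (rev w)))))
    (when-cong (does (ballotFrom? (suc s) (rev w))) x≈y)

  when-rev : ∀ {m} s c (w : Vec Letter m) x →
             when (does (ballotFrom? s (rev (w ∷ʳ c)))) x ≈ when (does (ballotFrom? s (c ∷ rev w))) x
  when-rev s c w x = reflexive (≡.cong (λ u → when (does (ballotFrom? s u)) x) (reverse-∷ʳ w c))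

  W-zero : ∀ s → W 0 s ≈ 1#
  W-zero s = +-identityʳ 1#

  -- The last letter of a word comes first in its reversal. A final R raises the head start and is
  -- never in `D`; the words with a final L are those of `V`.
  W-suc : ∀ n s → W (suc n) s ≈ V n s + W n (suc s)
  W-suc n s = begin
    W (suc n) s
      ≈⟨ sum-tuples-∷ʳ letters n _ ⟩
    sumOver (tuples letters n) (λ w → sumOver letters (λ c → when (does (ballotFrom? s (rev (w ∷ʳ c)))) (weight (w ∷ʳ c))))
      ≈⟨ sum-cong (tuples letters n) (λ w → trans
           (sum-letters (λ c → when (does (ballotFrom? s (rev (w ∷ʳ c)))) (weight (w ∷ʳ c)))) (+-cong
           (when-rev s L w _)
           (trans (when-rev s R w _) (when-R s w (weight-end w R (¬startsL-R w)))))) ⟩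
    sumOver (tuples letters n) (λ w → when (does (ballotFrom? s (L ∷ rev w))) (weight (w ∷ʳ L)) +
                                      when (does (ballotFrom? (suc s) (rev w))) (weight w))
      ≈⟨ sum-+ (tuples letters n) _ _ ⟩
    V n s + W n (suc s) ∎

  V-0 : ∀ n → V n 0 ≈ 0#
  V-0 n = trans
    (sum-cong (tuples letters n) (λ w → reflexive (≡.cong (λ b → when b (weight (w ∷ʳ L)))
      (dec-false (ballotFrom? 0 (L ∷ rev w)) (¬ballotFrom-0-L (rev w))))))
    (sum-0 (tuples letters n))

  V-zero : ∀ s → V 0 (suc s) ≈ z 0
  V-zero s = trans (+-identityʳ _) (*-identityʳ (z 0))

  -- The letter before the final L decides its weight. After another L it adds nothing, and dropping
  -- it leaves `V n s`. After R it opens a run at position n + 1, and dropping both letters restores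
  -- the allowance `suc s`.
  V-suc : ∀ n s → V (suc n) (suc s) ≈ V n s + z (suc n) * W n (suc s)
  V-suc n s = begin
    V (suc n) (suc s)
      ≈⟨ sum-tuples-∷ʳ letters n _ ⟩
    sumOver (tuples letters n) (λ w → sumOver letters (λ c →
      when (does (ballotFrom? (suc s) (L ∷ rev (w ∷ʳ c)))) (weight (w ∷ʳ c ∷ʳ L))))
      ≈⟨ sum-cong (tuples letters n) (λ w → trans
           (sum-letters (λ c → when (does (ballotFrom? (suc s) (L ∷ rev (w ∷ʳ c)))) (weight (w ∷ʳ c ∷ʳ L)))) (+-cong
           (trans (drop-L w L) (when-cong (does (ballotFrom? s (L ∷ rev w))) (weight-end (w ∷ʳ L) L (¬startsL-LL w))))
           (trans (drop-L w R) (trans (when-R s w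
             (trans (weight-start (w ∷ʳ R) L (startsL-RL w)) (*-congˡ (weight-end w R (¬startsL-R w)))))
             (sym (when-*ˡ (does (ballotFrom? (suc s) (rev w))) _ _)))))) ⟩
    sumOver (tuples letters n) (λ w → when (does (ballotFrom? s (L ∷ rev w))) (weight (w ∷ʳ L)) +
                                      z (suc n) * when (does (ballotFrom? (suc s) (rev w))) (weight w))
      ≈⟨ trans (sum-+ (tuples letters n) _ _) (+-congˡ (sym (sum-*ˡ (tuples letters n) (z (suc n)) _))) ⟩
    V n s + z (suc n) * W n (suc s) ∎
    where
    drop-L : ∀ (w : Vec Letter n) c → when (does (ballotFrom? (suc s) (L ∷ rev (w ∷ʳ c)))) (weight (w ∷ʳ c ∷ʳ L)) ≈
                                      when (does (ballotFrom? s (c ∷ rev w))) (weight (w ∷ʳ c ∷ʳ L))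
    drop-L w c = trans
      (reflexive (≡.cong (λ b → when b (weight (w ∷ʳ c ∷ʳ L)))
        (does-⇔ (ballotFrom-L s (rev (w ∷ʳ c))) (ballotFrom? (suc s) (L ∷ rev (w ∷ʳ c))) (ballotFrom? s (rev (w ∷ʳ c))))))
      (when-rev s c w _)

-- Comparing the recursions

module Matching (T : CommutativeRing 0ℓ 0ℓ) (z : ℕ → CommutativeRing.Carrier T) where
  open CommutativeRing T
  open Sums T using (prodOver; prod-++)
  open Words T z using (W; V; W-zero; W-suc; V-0; V-zero; V-suc)
  open SetoidReasoning setoid
  open GroupProperties +-group using (∙-cancelʳ; //-rightDividesˡ)
  open RingProperties ring using (-‿distribʳ-*)
  open CommutativeSemigroupProperties +-commutativeSemigroup using (x∙yz≈y∙xz; xy∙z≈yz∙x)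

  denominator : ℕ → Carrier
  denominator n = prodOver (upTo (suc n)) (λ i → 1# + - z i)

  denominator-zero : denominator 0 ≈ 1# + - z 0
  denominator-zero = *-identityʳ _

  denominator-suc : ∀ n → denominator (suc n) ≈ denominator n * (1# + - z (suc n))
  denominator-suc n = begin
    denominator (suc n)
      ≡⟨ ≡.cong (λ is → prodOver is (λ i → 1# + - z i)) (List.applyUpTo-∷ʳ id (suc n)) ⟨
    prodOver (upTo (suc n) ++ suc n ∷ []) (λ i → 1# + - z i)
      ≈⟨ prod-++ (upTo (suc n)) (suc n ∷ []) _ ⟩
    denominator n * ((1# + - z (suc n)) * 1#)
      ≈⟨ *-congˡ (*-identityʳ _) ⟩
    denominator n * (1# + - z (suc n)) ∎

  *-1- : ∀ x y → x * (1# + - y) + y * x ≈ x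
  *-1- x y = begin
    x * (1# + - y) + y * x         ≈⟨ +-cong (distribˡ x 1# (- y)) (*-comm y x) ⟩
    (x * 1# + x * - y) + x * y     ≈⟨ +-congʳ (+-cong (*-identityʳ x) (sym (-‿distribʳ-* x y))) ⟩
    (x + - (x * y)) + x * y        ≈⟨ //-rightDividesˡ (x * y) x ⟩
    x                              ∎

  -- Used with `c = z n`: the chains ending at the root itself move to the left-hand side and become
  -- the denominator factor of its rank.
  move-term : ∀ {x y u c} → x + y ≈ u + c * x → x * (1# + - c) + y ≈ u
  move-term {x} {y} {u} {c} eq = ∙-cancelʳ (c * x) _ _ (begin
    (x * (1# + - c) + y) + c * x    ≈⟨ +-assoc _ _ _ ⟩
    x * (1# + - c) + (y + c * x)    ≈⟨ +-congˡ (+-comm y (c * x)) ⟩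
    x * (1# + - c) + (c * x + y)    ≈⟨ +-assoc _ _ _ ⟨
    (x * (1# + - c) + c * x) + y    ≈⟨ +-congʳ (*-1- x c) ⟩
    x + y                           ≈⟨ eq ⟩
    u + c * x                       ∎)

  module _ (N : ℕ) (G : ℕ → ℕ → Carrier)
    (G-∅ : ∀ a b → b ℕ.≤ a → G a b ≈ 1#)
    (G-diagonal : ∀ a b → N ≡ a ℕ.+ suc b → G a (suc b) ≈ G a b)
    (G-step : ∀ n a b → b ≡ a ℕ.+ n → a ℕ.+ suc b ℕ.< N →
              G a (suc b) * (1# + - z n) + G (suc a) b ≈ G (suc a) (suc b) + G a b)
    where

    -- s = 2r − 1 − a − b is the number of surplus letters R on the way from the
    -- highest root to (a , b).
    numerator : ∀ n s a b → b ≡ suc (a ℕ.+ n) → N ≡ a ℕ.+ b ℕ.+ suc s → G a b * denominator n ≈ W n s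
    -- Absorbs the subtracted term in the step for (a , b + 1): the excess of `G (suc a) (suc b)`
    -- over `G (suc a) b`, with denominators cleared, counts the words whose descent from (a , b +
    -- 1) starts with L.
    corner : ∀ n s a b → b ≡ suc (a ℕ.+ n) → N ≡ a ℕ.+ suc b ℕ.+ suc s →
             G (suc a) (suc b) * denominator n ≈ G (suc a) b * denominator n + V n s

    numerator zero s a (suc b) b≡ N≡ = begin
      G a (suc b) * denominator 0       ≈⟨ *-congˡ denominator-zero ⟩
      G a (suc b) * (1# + - z 0)
        -- At rank 0 the three smaller regions are empty, so the recursion reads G (1 - z 0) + 1 = 1
        -- + 1.
        ≈⟨ ∙-cancelʳ 1# _ _ (begin
             G a (suc b) * (1# + - z 0) + 1#           ≈⟨ +-congˡ (G-∅ (suc a) b (ℕ.m≤n⇒m≤1+n b≤a)) ⟨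
             G a (suc b) * (1# + - z 0) + G (suc a) b  ≈⟨ G-step 0 a b (ℕ.suc-injective b≡) a+b<N ⟩
             G (suc a) (suc b) + G a b                 ≈⟨ +-cong (G-∅ (suc a) (suc b) (ℕ.s≤s b≤a)) (G-∅ a b b≤a) ⟩
             1# + 1#                                   ∎) ⟩
      1#                                ≈⟨ W-zero s ⟨
      W 0 s                             ∎
      where
      b≤a : b ℕ.≤ a
      b≤a = ℕ.≤-reflexive (≡.trans (ℕ.suc-injective b≡) (ℕ.+-identityʳ a))
      a+b<N : a ℕ.+ suc b ℕ.< N
      a+b<N = ≡.subst (a ℕ.+ suc b ℕ.<_) (≡.sym N≡) (ℕ.m<m+n _ ℕ.z<s)
    numerator (suc n) s a (suc b) b≡ N≡ = begin
      X * denominator (suc n)     ≈⟨ *-congˡ (denominator-suc n) ⟩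
      X * (d * p)                 ≈⟨ trans (*-congˡ (*-comm d p)) (sym (*-assoc X p d)) ⟩
      (X * p) * d
        -- Adding `Y * d` makes `G-step` applicable; `corner` returns the same `Y * d` on the other
        -- side, where it cancels.
        ≈⟨ ∙-cancelʳ (Y * d) _ _ (begin
             (X * p) * d + Y * d         ≈⟨ distribʳ d (X * p) Y ⟨
             (X * p + Y) * d             ≈⟨ *-congʳ (G-step (suc n) a b (ℕ.suc-injective b≡) a+b<N) ⟩
             (U + Z) * d                 ≈⟨ distribʳ d U Z ⟩
             U * d + Z * d               ≈⟨ +-cong (corner n s a b b≡′ N≡) (numerator n (suc s) a b b≡′ N≡′) ⟩
             (Y * d + V n s) + W n (suc s) ≈⟨ xy∙z≈yz∙x _ _ _ ⟩
             (V n s + W n (suc s)) + Y * d ∎) ⟩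
      V n s + W n (suc s)         ≈⟨ W-suc n s ⟨
      W (suc n) s                 ∎
      where
      d p X Y U Z : Carrier
      d = denominator n
      p = 1# + - z (suc n)
      X = G a (suc b)
      Y = G (suc a) b
      U = G (suc a) (suc b)
      Z = G a b
      b≡′ : b ≡ suc (a ℕ.+ n)
      b≡′ = ≡.trans (ℕ.suc-injective b≡) (ℕ.+-suc a n)
      N≡′ : N ≡ a ℕ.+ b ℕ.+ suc (suc s)
      N≡′ = ≡.trans N≡ (≡.trans (≡.cong (ℕ._+ suc s) (ℕ.+-suc a b)) (≡.sym (ℕ.+-suc (a ℕ.+ b) (suc s))))
      a+b<N : a ℕ.+ suc b ℕ.< N
      a+b<N = ≡.subst (a ℕ.+ suc b ℕ.<_) (≡.sym N≡) (ℕ.m<m+n _ ℕ.z<s)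

    -- Without surplus, (a + 1) + (b + 1) equals `N`, so `G-diagonal` applies; on the side of words,
    -- no allowance is left for an L.
    corner n zero a b b≡ N≡ = begin
      G (suc a) (suc b) * denominator n      ≈⟨ *-congʳ (G-diagonal (suc a) b (≡.trans N≡ (ℕ.+-comm _ 1))) ⟩
      G (suc a) b * denominator n            ≈⟨ trans (+-congˡ (V-0 n)) (+-identityʳ _) ⟨
      G (suc a) b * denominator n + V n 0    ∎
    corner n (suc s) a b b≡ N≡ = begin
      G (suc a) (suc b) * denominator n
        ≈⟨ numerator n s (suc a) (suc b) (≡.cong suc b≡) (≡.trans N≡ (ℕ.+-suc _ (suc s))) ⟩
      W n s
        ≈⟨ lemma n b≡ ⟩
      G (suc a) b * denominator n + V n (suc s) ∎
      where
      lemma : ∀ n → b ≡ suc (a ℕ.+ n) → W n s ≈ G (suc a) b * denominator n + V n (suc s)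
      lemma zero b≡ = begin
        W 0 s                                      ≈⟨ W-zero s ⟩
        1#                                         ≈⟨ *-1- 1# (z 0) ⟨
        1# * (1# + - z 0) + z 0 * 1#
          ≈⟨ +-cong (*-cong (sym (G-∅ (suc a) b (ℕ.≤-reflexive (≡.trans b≡ (≡.cong suc (ℕ.+-identityʳ a))))))
                            (sym denominator-zero))
                    (trans (*-identityʳ (z 0)) (sym (V-zero s))) ⟩
        G (suc a) b * denominator 0 + V 0 (suc s)  ∎
      lemma (suc n) b≡ = begin
        W (suc n) s                      ≈⟨ W-suc n s ⟩
        -- The part `w * (1# + - z (suc n))` brings the denominator factor that `G (suc a) b` needs
        -- to reach `denominator (suc n)`; the part `z (suc n) * w` is the contribution of the words
        -- ending in R L.
        V n s + w                        ≈⟨ +-congˡ (*-1- w (z (suc n))) ⟨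
        V n s + (w * (1# + - z (suc n)) + z (suc n) * w)
          ≈⟨ x∙yz≈y∙xz _ _ _ ⟩
        w * (1# + - z (suc n)) + (V n s + z (suc n) * w)
          ≈⟨ +-cong (*-congʳ (numerator n (suc s) (suc a) b (≡.trans b≡ (≡.cong suc (ℕ.+-suc a n)))
                       (≡.trans N≡ (≡.cong (ℕ._+ suc (suc s)) (ℕ.+-suc a b)))))
                    (V-suc n s) ⟨
        (G (suc a) b * denominator n) * (1# + - z (suc n)) + V (suc n) (suc s)
          ≈⟨ +-congʳ (trans (*-assoc _ _ _) (*-congˡ (sym (denominator-suc n)))) ⟩
        G (suc a) b * denominator (suc n) + V (suc n) (suc s) ∎
        where
        w : Carrier
        w = W n (suc s)

-- The recursion for chains of roots

rk+lower : ∀ {r} (α : PosRoot r) {n} → upper α ≡ suc (lower α ℕ.+ n) → rk α ≡ n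
rk+lower α {n} u≡ = ≡.cong (_∸ 1) (ℕ.+-cancelʳ-≡ (lower α) (ht α) (suc n)
  (≡.trans (ht+lower α) (≡.trans u≡ (≡.cong suc (ℕ.+-comm (lower α) n)))))

module RootNumerator (R : CommutativeRing 0ℓ 0ℓ) (x : CommutativeRing.Carrier R) (r : ℕ) where
  open CommutativeRing R
  open RawSemiringDefs (RawRing.rawSemiring rawRing) using (_^_)
  open RootChains R r (λ α → x ^ rk α) public
  open SetoidReasoning setoid
  open PowerSeries R using (commutativeRing; const-*; indeterminate-*-zero; indeterminate-*-suc)

  private module S = CommutativeRing commutativeRing

  z : ℕ → S.Carrier
  z n = const rawRing (x ^ n) S.* indeterminate rawRing

  G : ℕ → ℕ → S.Carrier
  G a b m = below m (inside a b)

  G-∅ : ∀ a b → b ℕ.≤ a → G a b S.≈ S.1#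
  G-∅ a b b≤a zero    = refl
  G-∅ a b b≤a (suc m) = below-∅ m (inside-∅ a b b≤a)

  G-diagonal : ∀ a b → r ℕ.+ r ≡ a ℕ.+ suc b → G a (suc b) S.≈ G a b
  G-diagonal a b r+r≡ m = below-cong m (inside-diagonal a b r+r≡)

  z-*-zero : ∀ n F → (z n S.* F) 0 ≈ 0#
  z-*-zero n F = trans (S.*-assoc (const rawRing (x ^ n)) (indeterminate rawRing) F 0)
    (trans (const-* (x ^ n) (indeterminate rawRing S.* F) 0) (trans (*-congˡ (indeterminate-*-zero F)) (zeroʳ _)))

  z-*-suc : ∀ n F m → (z n S.* F) (suc m) ≈ x ^ n * F m
  z-*-suc n F m = trans (S.*-assoc (const rawRing (x ^ n)) (indeterminate rawRing) F (suc m))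
    (trans (const-* (x ^ n) (indeterminate rawRing S.* F) (suc m)) (*-congˡ (indeterminate-*-suc F m)))

  G-recursion : ∀ n a b → b ≡ a ℕ.+ n → (∃ λ (α : PosRoot r) → lower α ≡ a × upper α ≡ suc b) →
                G a (suc b) S.+ G (suc a) b S.≈ (G (suc a) (suc b) S.+ G a b) S.+ z n S.* G a (suc b)
  -- In degree 0 each `G` counts the empty chain once, and `z n` has no constant term.
  G-recursion n a b b≡ _ zero = sym (trans (+-congˡ (z-*-zero n (G a (suc b)))) (+-identityʳ _))
  G-recursion n a b b≡ (α , ≡.refl , u≡) (suc m) = begin
    G a (suc b) (suc m) + G (suc a) b (suc m)
      ≈⟨ below-inclusion-exclusion m α b u≡ ⟩
    (G (suc a) (suc b) (suc m) + G a b (suc m)) + x ^ rk α * G a (suc b) m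
      ≡⟨ ≡.cong (λ k → (G (suc a) (suc b) (suc m) + G a b (suc m)) + x ^ k * G a (suc b) m)
           (rk+lower α (≡.trans u≡ (≡.cong suc b≡))) ⟩
    (G (suc a) (suc b) (suc m) + G a b (suc m)) + x ^ n * G a (suc b) m
      ≈⟨ +-congˡ (z-*-suc n (G a (suc b)) m) ⟨
    (G (suc a) (suc b) (suc m) + G a b (suc m)) + (z n S.* G a (suc b)) (suc m) ∎

  G-step : ∀ n a b → b ≡ a ℕ.+ n → a ℕ.+ suc b ℕ.< r ℕ.+ r →
           G a (suc b) S.* (S.1# S.+ S.- z n) S.+ G (suc a) b S.≈ G (suc a) (suc b) S.+ G a b
  G-step n a b b≡ a+b< = Matching.move-term commutativeRing z
    {G a (suc b)} {G (suc a) b} {G (suc a) (suc b) S.+ G a b} {z n}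
    (G-recursion n a b b≡ (coords-surjective a (suc b)
      (ℕ.s≤s (≡.subst (a ℕ.≤_) (≡.sym b≡) (ℕ.m≤m+n a n))) a+b<))

  -- The instance at the highest root: coordinates (0 , 2r - 1), rank 2r - 2, surplus 0.
  root-numerator : ∀ n → r ℕ.+ r ≡ suc (suc n) →
    (λ m → below m (λ _ → true)) S.* Matching.denominator commutativeRing z n S.≈ Words.W commutativeRing z n 0
  root-numerator n r+r≡ = S.trans
    (S.*-congʳ {Matching.denominator commutativeRing z n} {λ m → below m (λ _ → true)} {G 0 (suc n)}
      (λ m → below-cong m (inside-⊤ 0 (suc n) ≡.refl r+r≡)))
    (Matching.numerator commutativeRing z (r ℕ.+ r) G G-∅ G-diagonal G-step n 0 0 (suc n) ≡.refl
      (≡.trans r+r≡ (≡.sym (ℕ.+-comm (suc n) 1))))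

ℤ⟦q⟧-ring ℤ⟦q⟧⟦t⟧-ring : CommutativeRing 0ℓ 0ℓ
ℤ⟦q⟧-ring     = PowerSeries.commutativeRing ℤ.+-*-commutativeRing
ℤ⟦q⟧⟦t⟧-ring = PowerSeries.commutativeRing ℤ⟦q⟧-ring

-- Products of weights as monomials

module _ (R : CommutativeRing 0ℓ 0ℓ) (x : CommutativeRing.Carrier R) where
  open CommutativeRing R
  open RawSemiringDefs (RawRing.rawSemiring rawRing) using (_^_)
  open Exp semiring using (^-homo-*)

  private
    module S = CommutativeRing (PowerSeries.commutativeRing R)
    module S^ = RawSemiringDefs (RawRing.rawSemiring S.rawRing)
    open CommutativeSemigroupProperties S.*-commutativeSemigroup using (interchange)
    open PowerSeries R using (const-homo-*; const-cong)

    ⟪_⟫ : Carrier → S.Carrier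
    ⟪_⟫ = const rawRing

    X : S.Carrier
    X = indeterminate rawRing

  prod-monomials : ∀ ns → Sums.prodOver (PowerSeries.commutativeRing R) ns (λ n → ⟪ x ^ n ⟫ S.* X) S.≈
                          ⟪ x ^ sum ns ⟫ S.* (X S^.^ length ns)
  prod-monomials []       = S.sym {⟪ 1# ⟫ S.* S.1#} {S.1#} (S.*-identityʳ ⟪ 1# ⟫)
  prod-monomials (n ∷ ns) = begin
    (⟪ x ^ n ⟫ S.* X) S.* Sums.prodOver (PowerSeries.commutativeRing R) ns (λ n → ⟪ x ^ n ⟫ S.* X)
      ≈⟨ S.*-congˡ {⟪ x ^ n ⟫ S.* X} (prod-monomials ns) ⟩
    (⟪ x ^ n ⟫ S.* X) S.* (⟪ x ^ sum ns ⟫ S.* (X S^.^ length ns))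
      ≈⟨ interchange ⟪ x ^ n ⟫ X ⟪ x ^ sum ns ⟫ (X S^.^ length ns) ⟩
    (⟪ x ^ n ⟫ S.* ⟪ x ^ sum ns ⟫) S.* (X S.* (X S^.^ length ns))
      ≈⟨ S.*-congʳ {X S.* (X S^.^ length ns)} {⟪ x ^ (n ℕ.+ sum ns) ⟫} {⟪ x ^ n ⟫ S.* ⟪ x ^ sum ns ⟫}
           (S.trans {⟪ x ^ (n ℕ.+ sum ns) ⟫} {⟪ x ^ n * x ^ sum ns ⟫} {⟪ x ^ n ⟫ S.* ⟪ x ^ sum ns ⟫}
             (const-cong (^-homo-* x n (sum ns))) (const-homo-* (x ^ n) (x ^ sum ns))) ⟨
    ⟪ x ^ (n ℕ.+ sum ns) ⟫ S.* (X S.* (X S^.^ length ns)) ∎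
    where open SetoidReasoning S.setoid

  vec-weight : ∀ r {m} (v : Vec (PosRoot r) m) → x ^ Vec.sum (Vec.map rk v) ≈ RootNumerator.weight R x r v
  vec-weight r []      = refl
  vec-weight r (α ∷ v) = trans (^-homo-* x (rk α) _) (*-congˡ (vec-weight r v))

-- The identity for the root poset of type B

module _ (r : ℕ) .{{_ : NonZero r}} where
  private
    n : ℕ
    n = 2 ℕ.* r ∸ 2

  r+r≡ : r ℕ.+ r ≡ suc (suc n)
  r+r≡ = ≡.trans (≡.cong (r ℕ.+_) (≡.sym (ℕ.+-identityʳ r)))
    (≡.sym (ℕ.m+[n∸m]≡n (ℕ.*-monoʳ-≤ 2 (ℕ.>-nonZero⁻¹ r))))

  rk≤ : ∀ (α : PosRoot r) → rk α ℕ.≤ n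
  rk≤ α = ℕ.∸-monoˡ-≤ 1 (begin
    ht α                    ≤⟨ ℕ.m≤m+n (ht α) (lower α) ⟩
    ht α ℕ.+ lower α        ≡⟨ ht+lower α ⟩
    upper α                 ≤⟨ ℕ.m≤n+m (upper α) (lower α) ⟩
    lower α ℕ.+ upper α     ≤⟨ ℕ.≤-pred (≡.subst (lower α ℕ.+ upper α ℕ.<_) r+r≡ (lower+upper< α)) ⟩
    suc n                   ∎)
    where open ℕ.≤-Reasoning

  H≡ : H (Φ⁺B r) ≡ n
  H≡ with α , l≡ , u≡ ← coords-surjective {r} 0 (suc n) ℕ.z<s (≡.subst (suc n ℕ.<_) (≡.sym r+r≡) ℕ.≤-refl) =
    ℕ.≤-antisym
      (max≤v⁺ ℕ.z≤n (All.map⁺ (All.universal rk≤ (posRoots r))))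
      (v≤max⁺ 0 (map rk (posRoots r)) (inj₂ (lose (∈-map⁺ rk (posRoots-complete α))
        (ℕ.≤-reflexive (≡.sym (rk+lower α (≡.trans u≡ (≡.cong (λ a → suc (a ℕ.+ n)) (≡.sym l≡)))))))))

  private
    module Num = RootNumerator ℤ⟦q⟧-ring q r
    module W = Words ℤ⟦q⟧⟦t⟧-ring Num.z
    module T = CommutativeRing ℤ⟦q⟧⟦t⟧-ring
    open Sums ℤ⟦q⟧⟦t⟧-ring using (sum-cong; sum-filter)

    chain-series : QT.Carrier
    chain-series m = Num.below m (λ _ → true)

    denominator : QT.Carrier
    denominator = Matching.denominator ℤ⟦q⟧⟦t⟧-ring Num.z n

    monomial : ∀ {m} → Vec Letter m → QT.Carrier
    monomial w = ⌜ q Q.^ sum (map toℕ (D w)) ⌝ QT.* t QT.^ length (D w)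

  A≈ : A (Φ⁺B r) QT.≈ chain-series
  A≈ m = CommutativeRing.trans ℤ⟦q⟧-ring {A (Φ⁺B r) m} {Q.sumOver (weakChains (Φ⁺B r) m) Num.weight} {chain-series m}
    (Sums.sum-cong ℤ⟦q⟧-ring (weakChains (Φ⁺B r) m) (vec-weight ℤ⟦q⟧-ring q r))
    (Num.chains-below m)

  weight-monomial : ∀ {m} (w : Vec Letter m) → W.weight w QT.≈ monomial w
  weight-monomial w = ≡.subst
    (λ k → W.weight w QT.≈ ⌜ q Q.^ sum (map toℕ (D w)) ⌝ QT.* t QT.^ k)
    (List.length-map toℕ (D w))
    (prod-monomials ℤ⟦q⟧-ring q (map toℕ (D w)))

  ℍ-words : ℍ (Φ⁺B r) QT.≈ QT.sumOver (𝓑 r) monomial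
  ℍ-words = begin
    ℍ (Φ⁺B r)
      -- Once `H` is replaced by `n`, the product is `denominator` by computation, since `z` has the
      -- form used in `ℍ`.
      ≡⟨ ≡.cong (λ h → A (Φ⁺B r) QT.* QT.prodOver (upTo (suc h)) (λ a → QT.1# QT.+ QT.- (⌜ q Q.^ a ⌝ QT.* t))) H≡ ⟩
    A (Φ⁺B r) QT.* denominator       ≈⟨ T.*-congʳ {denominator} {A (Φ⁺B r)} {chain-series} A≈ ⟩
    chain-series QT.* denominator    ≈⟨ Num.root-numerator n r+r≡ ⟩
    W.W n 0
      -- `ballot?` and `ballotFrom? 0` agree by computation, so filtering the words gives `W n 0`.
      ≈⟨ sum-filter (λ w → ballot? (List.reverse (Vec.toList w))) (tuples W.letters n) W.weight ⟨
    QT.sumOver (𝓑 r) W.weight        ≈⟨ sum-cong (𝓑 r) weight-monomial ⟩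
    QT.sumOver (𝓑 r) monomial        ∎
    where open SetoidReasoning T.setoid

-- Nonnegativity of the coefficients

record ContainsSemiring (R : RawRing 0ℓ 0ℓ) (P : RawRing.Carrier R → Set) : Set where
  open RawRing R
  open ListOps R
  open RawSemiringDefs rawSemiring using (_^_)
  field
    0∈ : P 0#
    1∈ : P 1#
    +∈ : ∀ {x y} → P x → P y → P (x + y)
    *∈ : ∀ {x y} → P x → P y → P (x * y)

  sum∈ : ∀ {A : Set} (xs : List A) {f : A → Carrier} → (∀ x → P (f x)) → P (sumOver xs f)
  sum∈ []       p = 0∈
  sum∈ (x ∷ xs) p = +∈ (p x) (sum∈ xs p)

  ^∈ : ∀ {x} n → P x → P (x ^ n)
  ^∈ zero    p = 1∈
  ^∈ (suc n) p = *∈ p (^∈ n p)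

  const∈ : ∀ {c} → P c → ∀ n → P (const R c n)
  const∈ p zero    = p
  const∈ p (suc n) = 0∈

  indeterminate∈ : ∀ n → P (indeterminate R n)
  indeterminate∈ 0             = 0∈
  indeterminate∈ 1             = 1∈
  indeterminate∈ (suc (suc n)) = 0∈

-- The Cauchy product is built from sums and products alone. Applied twice to the nonnegative
-- integers, this covers the sum over words, which involves no subtraction.
series-containsSemiring : ∀ {R P} → ContainsSemiring R P → ContainsSemiring (R ⟦X⟧) (λ f → ∀ n → P (f n))
series-containsSemiring P-closed = record
  { 0∈ = λ _ → 0∈
  ; 1∈ = const∈ 1∈
  ; +∈ = λ p q n → +∈ (p n) (q n)
  ; *∈ = λ p q n → sum∈ (upTo (suc n)) (λ i → *∈ (p i) (q (n ∸ i)))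
  }
  where open ContainsSemiring P-closed

nonNegative-containsSemiring : ContainsSemiring ℤ.+-*-rawRing (0ℤ ℤ.≤_)
nonNegative-containsSemiring = record
  { 0∈ = ℤ.≤-refl
  ; 1∈ = ℤ.+≤+ ℕ.z≤n
  ; +∈ = ℤ.+-mono-≤
  ; *∈ = λ { {ℤ.+ m} {ℤ.+ n} _ _ → ≡.subst (0ℤ ℤ.≤_) (ℤ.pos-* m n) (ℤ.+≤+ ℕ.z≤n) }
  }

theorem1p1 : ∀ (r : ℕ) .{{_ : NonZero r}} →
    (ℍ (Φ⁺B r) QT.≈ QT.sumOver (𝓑 r) (λ w → ⌜ q Q.^ sum (map toℕ (D w)) ⌝ QT.* t QT.^ length (D w)))
    × (∀ k n → 0ℤ ℤ.≤ coefficient (ℍ (Φ⁺B r)) k n)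
theorem1p1 r = ℍ-words r , λ k n → ≡.subst (0ℤ ℤ.≤_) (≡.sym (ℍ-words r k n))
  (QT≥0.sum∈ (𝓑 r) (λ w → QT≥0.*∈ (Q≥0.const∈ (Q≥0.^∈ (sum (map toℕ (D w))) Z≥0.indeterminate∈))
                                  (QT≥0.^∈ (length (D w)) Q≥0.indeterminate∈)) k n)
  where
  module Z≥0 = ContainsSemiring nonNegative-containsSemiring
  module Q≥0 = ContainsSemiring (series-containsSemiring nonNegative-containsSemiring)
  module QT≥0 = ContainsSemiring (series-containsSemiring (series-containsSemiring nonNegative-containsSemiring))
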